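{- For the four-peg puzzle, $T(0,4)=0$, and for every integer $n>0$, $$T(n,4)=\min_{\substack{l,m\ge 0\\ l+m=n-1}}\bigl\{2\,T(l,4)+2\,T(m,3)\bigr\}+1 .$$
   Context: The $k$-peg Tower of Hanoi with $n$ disks ($k\ge 3$, $n\ge 0$): there are $k$ pegs and $n$ disks of pairwise distinct sizes. Initially all disks are on one peg (the Source), stacked in decreasing size from bottom to top. A legal move takes the top disk of one peg and places it on top of the stack on another peg, provided that this other peg is empty or its top disk is larger than the moved disk. The goal is to reach the configuration in which all $n$ disks are on one prescribed peg other than the Source. $T(n,k)$ denotes the minimum number of legal moves needed to reach the goal. The case $k=3$ is the original Tower of Hanoi; the case $k=4$ is the "Reve's Puzzle". -}

module Defs where

open import Data.Fin.Base using (Fin; zero; suc)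
open import Data.Fin.Properties using (any?) renaming (_≟_ to _≟ᶠ_)
open import Data.List.Base using (List; []; _∷_; _++_; _∷ʳ_; upTo)
import Data.List.Properties as List
open import Data.List.Relation.Unary.All using (All; []; _∷_)
import Data.List.Relation.Unary.All as All
open import Data.Nat.Base using (ℕ; zero; suc; _+_; _≤_; _<_; s≤s)
open import Data.Nat.Properties
  using (_≟_; _<?_; ≤-refl; <⇒≤; ≮⇒≥; anyUpTo?)
open import Data.Nat.Induction using (<-rec)
open import Data.Product.Base using (∃; _×_; _,_; proj₁; proj₂)
open import Data.Vec.Base using (Vec; lookup; replicate; _[_]≔_)
open import Data.Vec.Properties
  using (≡-dec; lookup∘update; lookup∘update′; lookup-replicate;
         []≔-commutes; []≔-idempotent; []≔-lookup)
open import Relation.Binary.PropositionalEquality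
open import Relation.Nullary using (¬_; Dec; yes; no; contradiction)

private
  variable
    k t : ℕ

IsLeast : (ℕ → Set) → ℕ → Set
IsLeast P m = P m × (∀ {n} → P n → m ≤ n)

-- A disk is represented by its size; a stack lists its disks from top to
-- bottom.
Disk : Set
Disk = ℕ

Stack : Set
Stack = List Disk

State : ℕ → Set
State k = Vec Stack k

data Fits (d : Disk) : Stack → Set where
  empty  : Fits d []
  larger : ∀ {e es} → d < e → Fits d (e ∷ es)

infix 4 _⟶_ _⟶[_]_

data _⟶_ (s : State k) : State k → Set where
  move : ∀ {i j d ds} → i ≢ j → lookup s i ≡ d ∷ ds → Fits d (lookup s j) →
         s ⟶ (s [ i ]≔ ds) [ j ]≔ (d ∷ lookup s j)

data _⟶[_]_ (s : State k) : ℕ → State k → Set where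
  done : s ⟶[ 0 ] s
  step : ∀ {u v} → s ⟶ u → u ⟶[ t ] v → s ⟶[ suc t ] v

-- All n disks, of sizes 0 < 1 < … < n - 1, on peg p.
tower : ∀ n → Fin k → State k
tower n p = replicate _ [] [ p ]≔ upTo n

-- The data of the puzzle other than the number of disks: at least three pegs,
-- and a choice of two different ones as Source and goal.
record Pegs (k : ℕ) : Set where
  field
    k≥3         : 3 ≤ k
    source      : Fin k
    goal        : Fin k
    source≢goal : source ≢ goal

SolvableIn : ∀ n k → Pegs k → ℕ → Set
SolvableIn n k P t = tower n source ⟶[ t ] tower n goal
  where open Pegs P

------------------------------------------------------------------------
-- The minimum number of moves exists: whether t moves suffice is decidable,
-- and some number of moves suffices.

private
  fits? : ∀ d ds → Dec (Fits d ds)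
  fits? d []       = yes empty
  fits? d (e ∷ es) with d <? e
  ... | yes d<e = yes (larger d<e)
  ... | no  d≮e = no λ { (larger d<e) → d≮e d<e }

  -- A legal move from peg i to peg j after which Q holds.
  data MoveTo (s : State k) (Q : State k → Set) (i j : Fin k) : Set where
    moveTo : ∀ {d ds} → i ≢ j → lookup s i ≡ d ∷ ds → Fits d (lookup s j) →
             Q ((s [ i ]≔ ds) [ j ]≔ (d ∷ lookup s j)) → MoveTo s Q i j

  moveTo? : (s : State k) {Q : State k → Set} → (∀ u → Dec (Q u)) →
            ∀ i j → Dec (MoveTo s Q i j)
  moveTo? s Q? i j with i ≟ᶠ j
  ... | yes i≡j = no λ { (moveTo i≢j _ _ _) → i≢j i≡j }
  ... | no  i≢j with lookup s i in eq
  ...   | [] = no λ { (moveTo _ eq′ _ _) → contradiction (trans (sym eq) eq′) λ () }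
  ...   | d ∷ ds with fits? d (lookup s j)
  ...     | no ¬f = no λ { (moveTo _ eq′ f _) → case (trans (sym eq) eq′) f }
    where
    case : ∀ {e es} → d ∷ ds ≡ e ∷ es → ¬ Fits e (lookup s j)
    case refl = ¬f
  ...     | yes f with Q? ((s [ i ]≔ ds) [ j ]≔ (d ∷ lookup s j))
  ...       | yes q = yes (moveTo i≢j eq f q)
  ...       | no ¬q = no λ { (moveTo _ eq′ _ q) → case (trans (sym eq) eq′) q }
    where
    case : ∀ {e es} → d ∷ ds ≡ e ∷ es → ¬ _
    case refl = ¬q

  reach? : ∀ t (s v : State k) → Dec (s ⟶[ t ] v)
  reach? zero s v with ≡-dec (List.≡-dec _≟_) s v
  ... | yes refl = yes done
  ... | no  s≢v  = no λ { done → s≢v refl }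
  reach? (suc t) s v
    with any? (λ i → any? (λ j → moveTo? s (λ u → reach? t u v) i j))
  ... | yes (_ , _ , moveTo i≢j eq f r) = yes (step (move i≢j eq f) r)
  ... | no ¬m = no λ { (step (move i≢j eq f) r) → ¬m (_ , _ , moveTo i≢j eq f r) }

  least : {P : ℕ → Set} → (∀ n → Dec (P n)) → ∀ n → P n → ∃ (IsLeast P)
  least {P} P? = <-rec _ go
    where
    go : ∀ n → (∀ {m} → m < n → P m → ∃ (IsLeast P)) → P n → ∃ (IsLeast P)
    go n rec pn with anyUpTo? P? n
    ... | yes (m , m<n , pm) = rec m<n pm
    ... | no  ¬smaller = n , pn , λ pm → ≮⇒≥ λ m<n → ¬smaller (_ , m<n , pm)

  _⟶⟶_ : ∀ {t′} {s u v : State k} → s ⟶[ t ] u → u ⟶[ t′ ] v → s ⟶[ t + t′ ] v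
  done     ⟶⟶ q = q
  step m p ⟶⟶ q = step m (p ⟶⟶ q)

  endpoints : ∀ {s s′ v v′ : State k} → s ≡ s′ → v ≡ v′ → s ⟶[ t ] v → s′ ⟶[ t ] v′
  endpoints refl refl p = p

  thirdPeg : 3 ≤ k → (p q : Fin k) → ∃ λ r → r ≢ p × r ≢ q
  thirdPeg (s≤s (s≤s (s≤s _))) zero          zero          = suc zero , (λ ()) , λ ()
  thirdPeg (s≤s (s≤s (s≤s _))) zero          (suc zero)    = suc (suc zero) , (λ ()) , λ ()
  thirdPeg (s≤s (s≤s (s≤s _))) zero          (suc (suc _)) = suc zero , (λ ()) , λ ()
  thirdPeg (s≤s (s≤s (s≤s _))) (suc zero)    zero          = suc (suc zero) , (λ ()) , λ ()
  thirdPeg (s≤s (s≤s (s≤s _))) (suc (suc _)) zero          = suc zero , (λ ()) , λ ()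
  thirdPeg (s≤s (s≤s (s≤s _))) (suc _)       (suc _)       = zero , (λ ()) , λ ()

  -- The m smallest disks put on top of peg p.
  lay : ℕ → Fin k → State k → State k
  lay m p s = s [ p ]≔ (upTo m ++ lookup s p)

  lay-suc : ∀ m (p : Fin k) s → lay m p (s [ p ]≔ (m ∷ lookup s p)) ≡ lay (suc m) p s
  lay-suc m p s = begin
    (s [ p ]≔ (m ∷ S)) [ p ]≔ (upTo m ++ lookup (s [ p ]≔ (m ∷ S)) p)
      ≡⟨ []≔-idempotent s p ⟩
    s [ p ]≔ (upTo m ++ lookup (s [ p ]≔ (m ∷ S)) p)
      ≡⟨ cong (λ x → s [ p ]≔ (upTo m ++ x)) (lookup∘update p s _) ⟩
    s [ p ]≔ (upTo m ++ (m ∷ S))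
      ≡⟨ cong (s [ p ]≔_) (List.++-assoc (upTo m) (m ∷ []) S) ⟨
    s [ p ]≔ ((upTo m ∷ʳ m) ++ S)
      ≡⟨ cong (λ x → s [ p ]≔ (x ++ S)) (List.upTo-∷ʳ m) ⟩
    s [ p ]≔ (upTo (suc m) ++ S) ∎
    where
    open ≡-Reasoning
    S = lookup s p

  AllAbove : ℕ → State k → Set
  AllAbove m s = ∀ i → All (m ≤_) (lookup s i)

  fits : ∀ {m ds} → All (suc m ≤_) ds → Fits m ds
  fits []        = empty
  fits (m<d ∷ _) = larger m<d

  put-above : ∀ {m} (s : State k) p → AllAbove (suc m) s →
              AllAbove m (s [ p ]≔ (m ∷ lookup s p))
  put-above {m = m} s p above i with i ≟ᶠ p
  ... | yes refl = subst (All (m ≤_)) (sym (lookup∘update i s _))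
                     (≤-refl ∷ All.map <⇒≤ (above i))
  ... | no  i≢p  = subst (All (m ≤_)) (sym (lookup∘update′ i≢p s _))
                     (All.map <⇒≤ (above i))

  transfer : 3 ≤ k → ∀ m (s : State k) {p q} → p ≢ q → AllAbove m s →
             ∃ λ t → lay m p s ⟶[ t ] lay m q s
  transfer k≥3 zero s {p} {q} p≢q above =
    0 , endpoints (sym ([]≔-lookup s p)) (sym ([]≔-lookup s q)) done
  transfer k≥3 (suc m) s {p} {q} p≢q above with thirdPeg k≥3 p q
  ... | r , r≢p , r≢q =
    _ , endpoints (lay-suc m p s) (lay-suc m q s)
          (proj₂ first ⟶⟶ step (subst (u ⟶_) eq big) (proj₂ second))
    where
    open ≡-Reasoning
    p≢r = ≢-sym r≢p
    q≢p = ≢-sym p≢q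
    q≢r = ≢-sym r≢q
    s₁ = s [ p ]≔ (m ∷ lookup s p)
    s₂ = s [ q ]≔ (m ∷ lookup s q)
    u  = lay m r s₁
    first  = transfer k≥3 m s₁ p≢r (put-above s p above)
    second = transfer k≥3 m s₂ r≢q (put-above s q above)
    u-p : lookup u p ≡ m ∷ lookup s p
    u-p = trans (lookup∘update′ p≢r s₁ _) (lookup∘update p s _)
    u-q : lookup u q ≡ lookup s q
    u-q = trans (lookup∘update′ q≢r s₁ _) (lookup∘update′ q≢p s _)
    big : u ⟶ (u [ p ]≔ lookup s p) [ q ]≔ (m ∷ lookup u q)
    big = move p≢q u-p (subst (Fits m) (sym u-q) (fits (above q)))
    B₁ = upTo m ++ lookup s₁ r
    B₁≡B₂ : B₁ ≡ upTo m ++ lookup s₂ r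
    B₁≡B₂ = cong (upTo m ++_)
      (trans (lookup∘update′ r≢p s _) (sym (lookup∘update′ r≢q s _)))
    u-without : u [ p ]≔ lookup s p ≡ s [ r ]≔ B₁
    u-without = begin
      (s₁ [ r ]≔ B₁) [ p ]≔ lookup s p ≡⟨ []≔-commutes s₁ r p r≢p ⟩
      (s₁ [ p ]≔ lookup s p) [ r ]≔ B₁ ≡⟨ cong (_[ r ]≔ B₁) ([]≔-idempotent s p) ⟩
      (s [ p ]≔ lookup s p) [ r ]≔ B₁  ≡⟨ cong (_[ r ]≔ B₁) ([]≔-lookup s p) ⟩
      s [ r ]≔ B₁                      ∎
    eq : (u [ p ]≔ lookup s p) [ q ]≔ (m ∷ lookup u q) ≡ lay m r s₂
    eq = begin
      (u [ p ]≔ lookup s p) [ q ]≔ (m ∷ lookup u q)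
        ≡⟨ cong₂ (λ x y → x [ q ]≔ (m ∷ y)) u-without u-q ⟩
      (s [ r ]≔ B₁) [ q ]≔ (m ∷ lookup s q)
        ≡⟨ []≔-commutes s r q r≢q ⟩
      s₂ [ r ]≔ B₁
        ≡⟨ cong (s₂ [ r ]≔_) B₁≡B₂ ⟩
      lay m r s₂ ∎

solvable : ∀ n k (P : Pegs k) → ∃ (SolvableIn n k P)
solvable n k P = _ , endpoints (lay-empty source) (lay-empty goal)
                       (proj₂ (transfer k≥3 n (replicate k []) source≢goal above))
  where
  open Pegs P
  above : AllAbove n (replicate k [])
  above i = subst (All (n ≤_)) (sym (lookup-replicate i [])) []
  lay-empty : ∀ p → lay n p (replicate k []) ≡ tower n p
  lay-empty p = cong (replicate k [] [ p ]≔_)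
    (trans (cong (upTo n ++_) (lookup-replicate p [])) (List.++-identityʳ (upTo n)))

minimumMoves : ∀ n k (P : Pegs k) → ∃ (IsLeast (SolvableIn n k P))
minimumMoves n k P with solvable n k P
... | t , sol = least (λ t → reach? t _ _) t sol

T : ∀ n k → Pegs k → ℕ
T n k P = proj₁ (minimumMoves n k P)

T-isLeast : ∀ n k (P : Pegs k) → IsLeast (SolvableIn n k P) (T n k P)
T-isLeast n k P = proj₂ (minimumMoves n k P)

{-# OPTIONS --safe #-}
-- The bound T (l + m + 1) 4 ≤ 2 T l 4 + 2 T m 3 + 1 is the Frame–Stewart
-- strategy; that it is attained for some l and m is Bousch's theorem.  The
-- lower bound gives disk i the weight 2 ^ min (∇ i , l), where ∇ i is the
-- largest j with j (j + 1) / 2 ≤ i, and says: a play among the N smallest disks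
-- that ends with two pegs p and q empty takes at least
--   Ψ l E = (total weight of E) - (l - 1) 2 ^ l - 1
-- moves for every l, where E is the set of disks that start on p.  Since before
-- its first move and after its last move the largest disk needs two empty pegs,
-- this gives 2 Ψ l {0 , … , n - 1} + 1 ≤ T (n + 1) 4, and the best l makes it
-- the Frame–Stewart number.
--
-- The lower bound goes by induction on N and on the level l + 1.  Let the largest
-- disk D start on p (otherwise drop it), and look at the state z in which it
-- leaves p or q for another peg r.  The other disks are then on two pegs: a, which
-- is the remaining one of p and q and has to be vacated later on, and b.  If the
-- large disks of E are all on a, vacating it pays for D.  Otherwise let K be the
-- largest disk of E on b.  Before the first move of K the smaller disks pay Ψ l
-- for E, from its last move to z they pay Ψ l for those on b, and after z those on
-- a pay Ψ l; the last two sets together contain all disks below K, and this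
-- suffices unless exactly l disks of E are larger than K and smaller than D.
-- Then all of these are on a.  If D left from q, the price for a was also paid
-- between the arrival of D on q and z.  If D left from p, then 2 ^ l - 1 further
-- moves come either from the disks below K, namely if the moves of K and these l
-- disks use all four pegs, or else from the three-peg game.
module Submission where

open import Defs
open import Data.Empty using (⊥)
open import Data.Fin.Base using (Fin)
open import Data.Fin.Permutation.Components using (transpose; transpose-inverse)
open import Data.Fin.Properties using (all?; any?) renaming (_≟_ to _≟ᶠ_)
open import Data.List.Base using ([]; _∷_; _∷ʳ_; upTo)
import Data.List.Properties as List
open import Data.Nat.Base
open import Data.Nat.Induction using (<-rec)
open import Data.Nat.Properties
open import Data.Nat.Solver using (module +-*-Solver)
open import Data.Product.Base using (∃; ∃-syntax; _×_; _,_; proj₁; proj₂)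
open import Data.Sum.Base using (_⊎_; inj₁; inj₂)
open import Data.Unit.Base using (⊤; tt)
open import Data.Vec.Base using (tabulate; lookup; _[_]≔_; replicate)
open import Data.Vec.Properties
  using (tabulate∘lookup; tabulate-cong; lookup∘tabulate; lookup∘update;
         lookup∘update′; lookup-replicate)
open import Relation.Binary.Definitions using (tri<; tri≈; tri>)
open import Relation.Binary.PropositionalEquality
open import Relation.Nullary using (¬_; Dec; yes; no; contradiction; ¬?)
open import Relation.Nullary.Decidable using (_×-dec_; _→-dec_; toWitness)

-- Indicators and finite sums.

ind : {A : Set} → Dec A → ℕ
ind (yes _) = 1
ind (no _)  = 0

ind-yes : {A : Set} (A? : Dec A) → A → ind A? ≡ 1
ind-yes (yes _) _ = refl
ind-yes (no ¬a) a = contradiction a ¬a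

ind-no : {A : Set} (A? : Dec A) → ¬ A → ind A? ≡ 0
ind-no (yes a) ¬a = contradiction a ¬a
ind-no (no _)  _  = refl

ind≤1 : {A : Set} (A? : Dec A) → ind A? ≤ 1
ind≤1 (yes _) = ≤-refl
ind≤1 (no _)  = z≤n

ind-mono : {A B : Set} (A? : Dec A) (B? : Dec B) → (A → B) → ind A? ≤ ind B?
ind-mono (yes a) B? f = ≤-reflexive (sym (ind-yes B? (f a)))
ind-mono (no _)  B? f = z≤n

ind-disjoint : {A B C : Set} (A? : Dec A) (B? : Dec B) (C? : Dec C) →
               (A → C) → (B → C) → (A → ¬ B) → ind A? + ind B? ≤ ind C?
ind-disjoint (yes a) (yes b) C? f g ¬ab = contradiction b (¬ab a)
ind-disjoint (yes a) (no _)  C? f g ¬ab = ≤-reflexive (sym (ind-yes C? (f a)))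
ind-disjoint (no _)  B?      C? f g ¬ab = ind-mono B? C? g

Σ< : ℕ → (ℕ → ℕ) → ℕ
Σ< zero    f = 0
Σ< (suc n) f = Σ< n f + f n

Σ<-cong : ∀ n {f g : ℕ → ℕ} → (∀ {i} → i < n → f i ≡ g i) → Σ< n f ≡ Σ< n g
Σ<-cong zero    eq = refl
Σ<-cong (suc n) eq = cong₂ _+_ (Σ<-cong n (λ i<n → eq (m<n⇒m<1+n i<n))) (eq ≤-refl)

Σ<-mono : ∀ n {f g : ℕ → ℕ} → (∀ {i} → i < n → f i ≤ g i) → Σ< n f ≤ Σ< n g
Σ<-mono zero    le = z≤n
Σ<-mono (suc n) le = +-mono-≤ (Σ<-mono n (λ i<n → le (m<n⇒m<1+n i<n))) (le ≤-refl)

+-interchange : ∀ a b c d → (a + b) + (c + d) ≡ (a + c) + (b + d)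
+-interchange a b c d = begin
  (a + b) + (c + d) ≡⟨ +-assoc a b (c + d) ⟩
  a + (b + (c + d)) ≡⟨ cong (a +_) (+-assoc b c d) ⟨
  a + ((b + c) + d) ≡⟨ cong (λ x → a + (x + d)) (+-comm b c) ⟩
  a + ((c + b) + d) ≡⟨ cong (a +_) (+-assoc c b d) ⟩
  a + (c + (b + d)) ≡⟨ +-assoc a c (b + d) ⟨
  (a + c) + (b + d) ∎
  where open ≡-Reasoning

Σ<-+ : ∀ n (f g : ℕ → ℕ) → Σ< n (λ i → f i + g i) ≡ Σ< n f + Σ< n g
Σ<-+ zero    f g = refl
Σ<-+ (suc n) f g = trans (cong (_+ (f n + g n)) (Σ<-+ n f g))
                         (+-interchange (Σ< n f) (Σ< n g) (f n) (g n))

Σ<-*ˡ : ∀ n a (f : ℕ → ℕ) → Σ< n (λ i → a * f i) ≡ a * Σ< n f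
Σ<-*ˡ zero    a f = sym (*-zeroʳ a)
Σ<-*ˡ (suc n) a f = trans (cong (_+ a * f n) (Σ<-*ˡ n a f)) (sym (*-distribˡ-+ a (Σ< n f) (f n)))

-- Configurations and paths

-- Every natural number has a position as a disk, and `Path n` moves only those below `n`. The order
-- within a peg is determined by size, so pegs alone describe a state.
Conf : ℕ → Set
Conf k = ℕ → Fin k

record Step {k : ℕ} (n : ℕ) (c c′ : Conf k) : Set where
  field
    disk   : ℕ
    disk<n : disk < n
    moves  : c disk ≢ c′ disk
    clear  : ∀ {e} → e < disk → c e ≢ c disk × c e ≢ c′ disk
    rest   : ∀ {e} → e ≢ disk → c′ e ≡ c e
open Step public

infixr 5 _then_

data Path {k : ℕ} (n : ℕ) (c : Conf k) : Conf k → Set where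
  stay  : ∀ {c′} → c ≗ c′ → Path n c c′
  _then_ : ∀ {c′ c″} → Step n c c′ → Path n c′ c″ → Path n c c″


private
  variable
    k n : ℕ
    u v : Conf k

-- A play is never restricted to a set of disks; its moves are weighted by the indicator of the set
-- instead. Larger disks do not hinder smaller ones, so a bound for the `m` smallest disks applies
-- to every path through `cost (below m)`.
cost : (ℕ → ℕ) → Path n u v → ℕ
cost f (stay _)  = 0
cost f (s then π) = f (disk s) + cost f π

All-steps : {u v : Conf k} → (∀ {c c′ : Conf k} → Step n c c′ → Set) → Path n u v → Set
All-steps P (stay _)  = ⊤
All-steps P (s then π) = P s × All-steps P π

cost-mono : ∀ {f g : ℕ → ℕ} → (∀ d → f d ≤ g d) → (π : Path n u v) → cost f π ≤ cost g π
cost-mono le (stay _)  = z≤n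
cost-mono le (s then π) = +-mono-≤ (le (disk s)) (cost-mono le π)

cost-+ : ∀ (f g : ℕ → ℕ) (π : Path n u v) → cost (λ d → f d + g d) π ≡ cost f π + cost g π
cost-+ f g (stay _)  = refl
cost-+ f g (s then π) = trans (cong (f (disk s) + g (disk s) +_) (cost-+ f g π))
                           (+-interchange (f (disk s)) (g (disk s)) (cost f π) (cost g π))

step-from : ∀ {c c′ d : Conf k} → d ≗ c → Step n c c′ → Step n d c′
step-from {d = d} e s = record
  { disk   = disk s
  ; disk<n = disk<n s
  ; moves  = λ eq → moves s (trans (sym (e _)) eq)
  ; clear  = λ e<d → (λ eq → proj₁ (clear s e<d) (trans (sym (e _)) (trans eq (e _))))
                   , (λ eq → proj₂ (clear s e<d) (trans (sym (e _)) eq))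
  ; rest   = λ ne → trans (rest s ne) (sym (e _))
  }

path-from : ∀ {c c′ d : Conf k} → d ≗ c → Path n c c′ → Path n d c′
path-from e (stay e′) = stay (λ i → trans (e i) (e′ i))
path-from e (s then π) = step-from e s then π

cost-from : ∀ {f} {c c′ d : Conf k} (e : d ≗ c) (π : Path n c c′) →
            cost f (path-from e π) ≡ cost f π
cost-from e (stay _)  = refl
cost-from e (s then π) = refl

infixr 5 _▷_

_▷_ : {u v z : Conf k} → Path n u v → Path n v z → Path n u z
stay e    ▷ ρ = path-from e ρ
(s then π) ▷ ρ = s then (π ▷ ρ)

cost-▷ : ∀ f {u v z : Conf k} (π : Path n u v) (ρ : Path n v z) → cost f (π ▷ ρ) ≡ cost f π + cost f ρ
cost-▷ f (stay e)  ρ = cost-from e ρ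
cost-▷ f (s then π) ρ = trans (cong (f (disk s) +_) (cost-▷ f π ρ)) (sym (+-assoc (f (disk s)) _ _))

flip-step : ∀ {c c′ : Conf k} → Step n c c′ → Step n c′ c
flip-step {c = c} {c′} s = record
  { disk   = disk s
  ; disk<n = disk<n s
  ; moves  = ≢-sym (moves s)
  ; clear  = λ e<d → (λ eq → proj₂ (clear s e<d) (trans (sym (rest s (<⇒≢ e<d))) eq))
                   , (λ eq → proj₁ (clear s e<d) (trans (sym (rest s (<⇒≢ e<d))) eq))
  ; rest   = λ ne → sym (rest s ne)
  }

flip : Path n u v → Path n v u
flip (stay e)  = stay (λ i → sym (e i))
flip (s then π) = flip π ▷ (flip-step s then stay (λ _ → refl))

cost-flip : ∀ f (π : Path n u v) → cost f (flip π) ≡ cost f π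
cost-flip f (stay e)  = refl
cost-flip f (s then π) = begin
  cost f (flip π ▷ (flip-step s then stay _)) ≡⟨ cost-▷ f (flip π) _ ⟩
  cost f (flip π) + (f (disk s) + 0)     ≡⟨ cong₂ _+_ (cost-flip f π) (+-identityʳ _) ⟩
  cost f π + f (disk s)                  ≡⟨ +-comm (cost f π) _ ⟩
  f (disk s) + cost f π                  ∎
  where open ≡-Reasoning

-- The first move of a disk.

record FirstMove {k n : ℕ} (K : ℕ) {u v : Conf k} (π : Path n u v) : Set where
  field
    {mid}   : Conf k
    before  : Path n u mid
    after   : Path n mid v
    cost≡   : ∀ f → cost f π ≡ cost f before + cost f after
    after≥  : ∀ f → f K ≤ cost f after
    target  : Fin k
    target≢ : target ≢ u K
    free    : ∀ {i} → i < K → mid i ≢ u K × mid i ≢ target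
    still   : All-steps (λ s → disk s ≢ K) before

-- Just before `K` leaves its peg, both this peg and the target are free of smaller disks; this is
-- the kind of end state that `LowerBound` asks for.
first-move : ∀ K (π : Path n u v) → u K ≢ v K → FirstMove K π
first-move K (stay e) ne = contradiction (e K) ne
first-move {u = u} K (_then_ {c′ = c′} s π) ne with disk s ≟ K
... | yes refl = record
  { before  = stay (λ _ → refl)
  ; after   = s then π
  ; cost≡   = λ f → refl
  ; after≥  = λ f → m≤m+n (f (disk s)) _
  ; target  = c′ K
  ; target≢ = ≢-sym (moves s)
  ; free    = clear s
  ; still   = tt
  }
... | no d≢K = record
  { before  = s then M.before
  ; after   = M.after
  ; cost≡   = λ f → trans (cong (f (disk s) +_) (M.cost≡ f)) (sym (+-assoc (f (disk s)) _ _))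
  ; after≥  = M.after≥
  ; target  = M.target
  ; target≢ = λ eq → M.target≢ (trans eq (sym same))
  ; free    = λ i<K → (λ eq → proj₁ (M.free i<K) (trans eq (sym same))) , proj₂ (M.free i<K)
  ; still   = d≢K , M.still
  }
  where
  same : c′ K ≡ u K
  same = rest s (≢-sym d≢K)
  module M = FirstMove (first-move K π (λ eq → ne (trans (sym same) eq)))

-- The larger disk `d` lies under `K`, and a step requires all smaller disks to be off the peg that
-- it leaves.
disks-below-held : ∀ {K d p} (π : Path n u v) → All-steps (λ s → disk s ≢ K) π → K < d →
       u K ≡ p → u d ≡ p → v d ≡ p
disks-below-held (stay e) _ K<d uK ud = trans (sym (e _)) ud
disks-below-held {K = K} {d} (s then π) (ne , nes) K<d uK ud =
  disks-below-held π nes K<d (trans (rest s (≢-sym ne)) uK) (trans (rest s d≢) ud)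
  where
  d≢ : d ≢ disk s
  d≢ refl = proj₁ (clear s K<d) (trans uK (sym ud))

unmoved : ∀ {K} (π : Path n u v) → All-steps (λ s → disk s ≢ K) π → v K ≡ u K
unmoved (stay e) _ = sym (e _)
unmoved (s then π) (ne , nes) = trans (unmoved π nes) (rest s (≢-sym ne))

-- Kept abstract, as unfolding these exhaustive checks is expensive.
abstract
  another-peg : (x p q : Fin 4) → ∃ λ r → r ≢ x × r ≢ p × r ≢ q
  another-peg = toWitness {a? = all? λ x → all? λ p → all? λ q → any? λ r →
    ¬? (r ≟ᶠ x) ×-dec ¬? (r ≟ᶠ p) ×-dec ¬? (r ≟ᶠ q)} tt

  one-of-four : (p q r s : Fin 4) → p ≢ q → r ≢ p → r ≢ q → s ≢ p → s ≢ q → s ≢ r →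
                ∀ i → i ≢ p → i ≢ q → i ≢ r → i ≡ s
  one-of-four = toWitness {a? = all? λ p → all? λ q → all? λ r → all? λ s →
    ¬? (p ≟ᶠ q) →-dec ¬? (r ≟ᶠ p) →-dec ¬? (r ≟ᶠ q) →-dec
    ¬? (s ≟ᶠ p) →-dec ¬? (s ≟ᶠ q) →-dec ¬? (s ≟ᶠ r) →-dec
    all? λ i → ¬? (i ≟ᶠ p) →-dec ¬? (i ≟ᶠ q) →-dec ¬? (i ≟ᶠ r) →-dec (i ≟ᶠ s)} tt

-- The three-peg game avoiding x

module ThreePegs (x : Fin 4) (mem : ℕ → Set) (mem? : ∀ d → Dec (mem d)) where

  third : Fin 4 → Fin 4 → Fin 4
  third p q = proj₁ (another-peg x p q)

  third≢x : ∀ p q → third p q ≢ x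
  third≢x p q = proj₁ (proj₂ (another-peg x p q))

  third≢ˡ : ∀ p q → third p q ≢ p
  third≢ˡ p q = proj₁ (proj₂ (proj₂ (another-peg x p q)))

  third≢ʳ : ∀ p q → third p q ≢ q
  third≢ʳ p q = proj₂ (proj₂ (proj₂ (another-peg x p q)))

  third-unique : ∀ {p q i} → p ≢ x → q ≢ x → p ≢ q → i ≢ x → i ≢ p → i ≢ q → i ≡ third p q
  third-unique {p} {q} {i} p≢x q≢x p≢q =
    one-of-four x p q (third p q) (≢-sym p≢x) q≢x (≢-sym p≢q) (third≢x p q) (third≢ˡ p q) (third≢ʳ p q) i

  rank : ℕ → ℕ
  rank m = Σ< m (λ d → ind (mem? d))

  -- The distance of the members below m to the state with all of them on g.
  potential : Fin 4 → ℕ → Conf 4 → ℕ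
  potential g zero    c = 0
  potential g (suc m) c with mem? m
  ... | no _ = potential g m c
  ... | yes _ with c m ≟ᶠ g
  ...   | yes _ = potential g m c
  ...   | no _  = 2 ^ rank m + potential (third (c m) g) m c

  potential-goal : ∀ g m {c} → (∀ {i} → i < m → mem i → c i ≡ g) → potential g m c ≡ 0
  potential-goal g zero    at = refl
  potential-goal g (suc m) {c} at with mem? m
  ... | no _ = potential-goal g m (λ i<m → at (m<n⇒m<1+n i<m))
  ... | yes mm with c m ≟ᶠ g
  ...   | yes _ = potential-goal g m (λ i<m → at (m<n⇒m<1+n i<m))
  ...   | no ne = contradiction (at ≤-refl mm) ne

  -- The goal of the smaller members, a third peg, is again different from `p`; so every member
  -- doubles the price, as in the classical count 2 ^ n - 1.
  potential-tower : ∀ g p m {c} → p ≢ g → (∀ {i} → i < m → mem i → c i ≡ p) →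
                    suc (potential g m c) ≡ 2 ^ rank m
  potential-tower g p zero    p≢g at = refl
  potential-tower g p (suc m) {c} p≢g at with mem? m
  ... | no _ = trans (potential-tower g p m p≢g (λ i<m → at (m<n⇒m<1+n i<m)))
                     (cong (2 ^_) (sym (+-identityʳ (rank m))))
  ... | yes mm with c m ≟ᶠ g
  ...   | yes eq = contradiction (trans (sym (at ≤-refl mm)) eq) p≢g
  ...   | no _  = begin
    suc (2 ^ rank m + potential (third (c m) g) m c)
      ≡⟨ +-suc (2 ^ rank m) _ ⟨
    2 ^ rank m + suc (potential (third (c m) g) m c)
      ≡⟨ cong (2 ^ rank m +_)
           (potential-tower _ p m (λ eq → third≢ˡ (c m) g (trans (sym eq) (sym (at ≤-refl mm))))
                                  (λ i<m → at (m<n⇒m<1+n i<m))) ⟩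
    2 ^ rank m + 2 ^ rank m
      ≡⟨ cong (2 ^ rank m +_) (+-identityʳ (2 ^ rank m)) ⟨
    2 ^ suc (rank m)
      ≡⟨ cong (2 ^_) (+-comm 1 (rank m)) ⟩
    2 ^ (rank m + 1) ∎
    where open ≡-Reasoning

  potential-nonMember : ∀ g m {c} → ¬ mem m → potential g (suc m) c ≡ potential g m c
  potential-nonMember g m ¬m with mem? m
  ... | yes mm = contradiction mm ¬m
  ... | no _   = refl

  potential-there : ∀ g m {c} → mem m → c m ≡ g → potential g (suc m) c ≡ potential g m c
  potential-there g m {c} mm eq with mem? m
  ... | no ¬m = refl
  ... | yes _ with c m ≟ᶠ g
  ...   | yes _ = refl
  ...   | no ne = contradiction eq ne

  potential-away : ∀ g m {c} → mem m → c m ≢ g →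
                   potential g (suc m) c ≡ 2 ^ rank m + potential (third (c m) g) m c
  potential-away g m {c} mm ne with mem? m
  ... | no ¬m = contradiction mm ¬m
  ... | yes _ with c m ≟ᶠ g
  ...   | yes eq = contradiction eq ne
  ...   | no _   = refl

  potential-cong : ∀ g m {c c′} → (∀ {i} → i < m → c i ≡ c′ i) →
                   potential g m c ≡ potential g m c′
  potential-cong g zero    eq = refl
  potential-cong g (suc m) {c} {c′} eq = go (mem? m)
    where
    IH : ∀ g → potential g m c ≡ potential g m c′
    IH g = potential-cong g m (λ i<m → eq (m<n⇒m<1+n i<m))
    go : Dec (mem m) → potential g (suc m) c ≡ potential g (suc m) c′
    go (no ¬m) = trans (potential-nonMember g m ¬m) (trans (IH g) (sym (potential-nonMember g m ¬m)))
    go (yes mm) with c m ≟ᶠ g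
    ... | yes e = trans (potential-there g m mm e)
                    (trans (IH g) (sym (potential-there g m mm (trans (sym (eq ≤-refl)) e))))
    ... | no ne = trans (potential-away g m mm ne)
                    (trans (cong (2 ^ rank m +_) (trans (IH _) (cong (λ p → potential (third p g) m c′) (eq ≤-refl))))
                      (sym (potential-away g m mm (λ e → ne (trans (eq ≤-refl) e)))))

  memberWeight : ℕ → ℕ → ℕ
  memberWeight m d = ind (mem? d ×-dec d <? m)

  Off : ℕ → Conf 4 → Set
  Off m c = ∀ {i} → i < m → mem i → c i ≢ x

  OffStep : ℕ → ∀ {n} {c c′ : Conf 4} → Step n c c′ → Set
  OffStep m {n} {c} {c′} s = disk s < m → mem (disk s) → c (disk s) ≢ x × c′ (disk s) ≢ x

  Off-step : ∀ {m n} {c c′ : Conf 4} (s : Step n c c′) → OffStep m s → Off m c → Off m c′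
  Off-step s os off {i} i<m mi with i ≟ disk s
  ... | yes refl = proj₂ (os i<m mi)
  ... | no ne    = λ eq → off i<m mi (trans (sym (rest s ne)) eq)

  -- A distance to a fixed state grows by at most one per move. If the moved disk is smaller than
  -- the top member, the claim passes to the smaller members with their own goal; the real case is a
  -- move of the top member.
  potential-step : ∀ g m {n} {c c′ : Conf 4} → g ≢ x → (s : Step n c c′) → OffStep m s → Off m c →
                   potential g m c′ ≤ memberWeight m (disk s) + potential g m c
  potential-step g zero    g≢x s os off = z≤n
  potential-step g (suc m) {c = c} {c′} g≢x s os off with <-cmp m (disk s)
  ... | tri< m<d _ _ = ≤-trans (≤-reflexive (potential-cong g (suc m) (λ i<m → rest s (λ { refl → <⇒≱ m<d (s≤s⁻¹ i<m) }))))
                               (m≤n+m _ _)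
  ... | tri> _ _ d<m = go (mem? m)
    where
    same : c′ m ≡ c m
    same = rest s (≢-sym (<⇒≢ d<m))
    mono : memberWeight m (disk s) ≤ memberWeight (suc m) (disk s)
    mono = ind-mono (mem? (disk s) ×-dec disk s <? m) (mem? (disk s) ×-dec disk s <? suc m)
                    (λ (a , b) → a , m<n⇒m<1+n b)
    IH : ∀ g → g ≢ x → potential g m c′ ≤ memberWeight (suc m) (disk s) + potential g m c
    IH g g≢x = ≤-trans (potential-step g m g≢x s (λ d<m → os (m<n⇒m<1+n d<m)) (λ i<m → off (m<n⇒m<1+n i<m)))
                       (+-monoˡ-≤ _ mono)
    go : Dec (mem m) → potential g (suc m) c′ ≤ memberWeight (suc m) (disk s) + potential g (suc m) c
    go (no ¬m) rewrite potential-nonMember g m {c} ¬m | potential-nonMember g m {c′} ¬m = IH g g≢x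
    go (yes mm) with c m ≟ᶠ g
    ... | yes eq rewrite potential-there g m {c} mm eq | potential-there g m {c′} mm (trans same eq) = IH g g≢x
    ... | no ne rewrite potential-away g m {c} mm ne
                      | potential-away g m {c′} mm (λ eq → ne (trans (sym same) eq)) | same = begin
      2 ^ rank m + potential (third (c m) g) m c′
        ≤⟨ +-monoʳ-≤ (2 ^ rank m) (IH _ (third≢x (c m) g)) ⟩
      2 ^ rank m + (memberWeight (suc m) (disk s) + potential (third (c m) g) m c)
        ≡⟨ +-assoc (2 ^ rank m) _ _ ⟨
      2 ^ rank m + memberWeight (suc m) (disk s) + potential (third (c m) g) m c
        ≡⟨ cong (_+ potential (third (c m) g) m c) (+-comm (2 ^ rank m) _) ⟩
      memberWeight (suc m) (disk s) + 2 ^ rank m + potential (third (c m) g) m c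
        ≡⟨ +-assoc (memberWeight (suc m) (disk s)) _ _ ⟩
      memberWeight (suc m) (disk s) + (2 ^ rank m + potential (third (c m) g) m c) ∎
      where open ≤-Reasoning
  ... | tri≈ _ refl _ = go (mem? m)
    where
    go : Dec (mem m) → potential g (suc m) c′ ≤ memberWeight (suc m) m + potential g (suc m) c
    go (no ¬m) rewrite potential-nonMember g m {c} ¬m | potential-nonMember g m {c′} ¬m =
      ≤-trans (≤-reflexive (potential-cong g m (λ i<m → rest s (<⇒≢ i<m)))) (m≤n+m _ _)
    go (yes mm) = cases
      where
      w≡1 : memberWeight (suc m) m ≡ 1
      w≡1 = ind-yes (mem? m ×-dec m <? suc m) (mm , ≤-refl)
      cm≢x : c m ≢ x
      cm≢x = proj₁ (os ≤-refl mm)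
      c′m≢x : c′ m ≢ x
      c′m≢x = proj₂ (os ≤-refl mm)
      z : Fin 4
      z = third (c m) (c′ m)
      -- The smaller members are off both ends of the move and off `x`, which leaves a single peg.
      at : ∀ {i} → i < m → mem i → c i ≡ z
      at i<m mi = third-unique cm≢x c′m≢x (moves s) (off (m<n⇒m<1+n i<m) mi)
                    (proj₁ (clear s i<m)) (proj₂ (clear s i<m))
      at′ : ∀ {i} → i < m → mem i → c′ i ≡ z
      at′ i<m mi = trans (rest s (<⇒≢ i<m)) (at i<m mi)
      open ≤-Reasoning
      cases : potential g (suc m) c′ ≤ memberWeight (suc m) m + potential g (suc m) c
      cases rewrite w≡1 with c m ≟ᶠ g | c′ m ≟ᶠ g
      ... | yes e | yes e′ = contradiction (trans e (sym e′)) (moves s)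
      -- Leaving the goal costs exactly one: before, the tower on `z` has distance 2 ^ rank m - 1
      -- from `g`; after, it already stands on the third peg.
      ... | yes e | no ne′ = begin
        potential g (suc m) c′ ≡⟨ potential-away g m mm ne′ ⟩
        2 ^ rank m + potential (third (c′ m) g) m c′
          ≡⟨ cong (2 ^ rank m +_) (potential-goal _ m (λ i<m mi → trans (at′ i<m mi)
               (third-unique c′m≢x g≢x ne′ (third≢x _ _) (third≢ʳ _ _)
                 (λ eq → third≢ˡ (c m) (c′ m) (trans eq (sym e)))))) ⟩
        2 ^ rank m + 0 ≡⟨ +-identityʳ _ ⟩
        2 ^ rank m ≡⟨ potential-tower g z m (λ eq → third≢ˡ (c m) (c′ m) (trans eq (sym e))) at ⟨
        suc (potential g m c) ≡⟨ cong suc (potential-there g m mm e) ⟨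
        suc (potential g (suc m) c) ∎
      ... | no ne | yes e′ = begin
        potential g (suc m) c′ ≡⟨ potential-there g m mm e′ ⟩
        potential g m c′ ≤⟨ n≤1+n _ ⟩
        suc (potential g m c′) ≡⟨ potential-tower g z m (λ eq → third≢ʳ (c m) (c′ m) (trans eq (sym e′))) at′ ⟩
        2 ^ rank m ≤⟨ m≤m+n _ _ ⟩
        2 ^ rank m + potential (third (c m) g) m c ≡⟨ potential-away g m mm ne ⟨
        potential g (suc m) c ≤⟨ n≤1+n _ ⟩
        suc (potential g (suc m) c) ∎
      -- Here `z` is `g`, so before and after the move the tower on `z` has to go to another peg,
      -- and the two potentials agree.
      ... | no ne | no ne′ = begin
        potential g (suc m) c′ ≡⟨ potential-away g m mm ne′ ⟩
        2 ^ rank m + potential (third (c′ m) g) m c′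
          ≤⟨ +-monoʳ-≤ (2 ^ rank m) (n≤1+n _) ⟩
        2 ^ rank m + suc (potential (third (c′ m) g) m c′)
          ≡⟨ cong (2 ^ rank m +_) (trans (potential-tower _ z m (z≢ ne′) at′)
                                         (sym (potential-tower _ z m (z≢ ne) at))) ⟩
        2 ^ rank m + suc (potential (third (c m) g) m c)
          ≡⟨ +-suc (2 ^ rank m) _ ⟩
        suc (2 ^ rank m + potential (third (c m) g) m c) ≡⟨ cong suc (potential-away g m mm ne) ⟨
        suc (potential g (suc m) c) ∎
        where
        g≡z : g ≡ z
        g≡z = third-unique cm≢x c′m≢x (moves s) g≢x (≢-sym ne) (≢-sym ne′)
        z≢ : ∀ {p} → p ≢ g → z ≢ third p g
        z≢ _ eq = third≢ʳ _ g (trans (sym eq) (sym g≡z))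

  potential-path : ∀ g m {n} {c c′ : Conf 4} → g ≢ x → (π : Path n c c′) →
                   All-steps (OffStep m) π → Off m c →
                   potential g m c′ ≤ cost (memberWeight m) π + potential g m c
  potential-path g m g≢x (stay e) _ off = ≤-reflexive (potential-cong g m (λ _ → sym (e _)))
  potential-path g m {c = c} {c′} g≢x (_then_ {c′ = c₁} s π) (os , oss) off = begin
    potential g m c′
      ≤⟨ potential-path g m g≢x π oss (Off-step s os off) ⟩
    cost (memberWeight m) π + potential g m c₁
      ≤⟨ +-monoʳ-≤ (cost (memberWeight m) π) (potential-step g m g≢x s os off) ⟩
    cost (memberWeight m) π + (memberWeight m (disk s) + potential g m c)
      ≡⟨ +-assoc (cost (memberWeight m) π) _ _ ⟨
    cost (memberWeight m) π + memberWeight m (disk s) + potential g m c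
      ≡⟨ cong (_+ potential g m c) (+-comm (cost (memberWeight m) π) _) ⟩
    memberWeight m (disk s) + cost (memberWeight m) π + potential g m c ∎
    where open ≤-Reasoning

-- Triangular numbers and the weights of disks.

tri : ℕ → ℕ
tri zero    = 0
tri (suc l) = suc l + tri l

-- 2 ^ min (∇ i , l), where ∇ i is the largest j with tri j ≤ i.
weight : ℕ → ℕ → ℕ
weight zero    i = 1
weight (suc l) i = weight l i + 2 ^ l * ind (tri (suc l) ≤? i)

-- (l - 1) 2 ^ l + 1
offset : ℕ → ℕ
offset zero    = 0
offset (suc l) = offset l + 2 ^ l * suc l

offset-closed : ∀ l → offset l + 2 ^ l ≡ 2 ^ l * l + 1
offset-closed zero    = refl
offset-closed (suc l) = begin
  offset l + P * suc l + 2 * P     ≡⟨ solve 3 (λ c p l → c :+ p :* (con 1 :+ l) :+ con 2 :* p := c :+ p :+ (p :* (con 2 :+ l))) refl (offset l) P l ⟩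
  offset l + P + P * (2 + l)       ≡⟨ cong (_+ P * (2 + l)) (offset-closed l) ⟩
  P * l + 1 + P * (2 + l)      ≡⟨ solve 2 (λ p l → p :* l :+ con 1 :+ p :* (con 2 :+ l) := con 2 :* p :* (con 1 :+ l) :+ con 1) refl P l ⟩
  2 * P * suc l + 1            ∎
  where
  open ≡-Reasoning
  open +-*-Solver
  P = 2 ^ l

weight-large : ∀ l {i} → tri l ≤ i → weight l i ≡ 2 ^ l
weight-large zero    _  = refl
weight-large (suc l) {i} le = begin
  weight l i + 2 ^ l * ind (tri (suc l) ≤? i)
    ≡⟨ cong₂ (λ a b → a + 2 ^ l * b) (weight-large l (≤-trans (m≤n+m (tri l) (suc l)) le)) (ind-yes (tri (suc l) ≤? i) le) ⟩
  2 ^ l + 2 ^ l * 1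
    ≡⟨ cong (2 ^ l +_) (*-comm (2 ^ l) 1) ⟩
  2 ^ suc l ∎
  where open ≡-Reasoning

totalWeight : ℕ → ℕ → ℕ
totalWeight l m = Σ< m (weight l)

totalWeight-+ : ∀ l r → totalWeight l (tri l + r) ≡ totalWeight l (tri l) + 2 ^ l * r
totalWeight-+ l zero    = trans (cong (totalWeight l) (+-identityʳ (tri l)))
                      (sym (trans (cong (totalWeight l (tri l) +_) (*-zeroʳ (2 ^ l))) (+-identityʳ _)))
totalWeight-+ l (suc r) = begin
  totalWeight l (tri l + suc r)                   ≡⟨ cong (totalWeight l) (+-suc (tri l) r) ⟩
  totalWeight l (tri l + r) + weight l (tri l + r)     ≡⟨ cong₂ _+_ (totalWeight-+ l r) (weight-large l (m≤m+n (tri l) r)) ⟩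
  totalWeight l (tri l) + 2 ^ l * r + 2 ^ l       ≡⟨ solve 3 (λ a p r → a :+ p :* r :+ p := a :+ p :* (con 1 :+ r)) refl (totalWeight l (tri l)) (2 ^ l) r ⟩
  totalWeight l (tri l) + 2 ^ l * suc r           ∎
  where
  open ≡-Reasoning
  open +-*-Solver

-- For each j ≤ l there are j + 1 disks of weight 2 ^ j, and the sum of (j + 1) 2 ^ j is l 2 ^ (l +
-- 1) + 1.
totalWeight-tri : ∀ l → totalWeight l (tri (suc l)) ≡ offset (suc l)
totalWeight-tri zero    = refl
totalWeight-tri (suc l) = begin
  totalWeight (suc l) (suc (suc l) + tri (suc l))             ≡⟨ cong (totalWeight (suc l)) (+-comm (suc (suc l)) (tri (suc l))) ⟩
  totalWeight (suc l) (tri (suc l) + suc (suc l))             ≡⟨ totalWeight-+ (suc l) (suc (suc l)) ⟩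
  totalWeight (suc l) (tri (suc l)) + 2 ^ suc l * suc (suc l) ≡⟨ cong (_+ 2 ^ suc l * suc (suc l)) (trans (Σ<-cong (tri (suc l)) small) (totalWeight-tri l)) ⟩
  offset (suc (suc l))                                  ∎
  where
  open ≡-Reasoning
  small : ∀ {i} → i < tri (suc l) → weight (suc l) i ≡ weight l i
  small {i} i<t = begin
    weight l i + 2 ^ l * ind (tri (suc l) ≤? i) ≡⟨ cong (λ a → weight l i + 2 ^ l * a) (ind-no (tri (suc l) ≤? i) (<⇒≱ i<t)) ⟩
    weight l i + 2 ^ l * 0                      ≡⟨ cong (weight l i +_) (*-zeroʳ (2 ^ l)) ⟩
    weight l i + 0                              ≡⟨ +-identityʳ _ ⟩
    weight l i ∎

-- Sums over the disks on a given peg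

weightOn : ℕ → ℕ → Conf k → Fin k → ℕ
weightOn l m c p = Σ< m (λ i → ind (c i ≟ᶠ p) * weight l i)

largeOn : ℕ → ℕ → Conf k → Fin k → ℕ
largeOn l m c p = Σ< m (λ i → ind (c i ≟ᶠ p) * ind (tri l ≤? i))

-- Passing to the next level doubles the weight 2 ^ l of the disks from `tri (suc l)` on and keeps
-- all others.
weightOn-suc : ∀ l m (c : Conf k) p → weightOn (suc l) m c p ≡ weightOn l m c p + 2 ^ l * largeOn (suc l) m c p
weightOn-suc l m c p = begin
  Σ< m (λ i → ind (c i ≟ᶠ p) * (weight l i + 2 ^ l * r i))
    ≡⟨ Σ<-cong m (λ {i} _ → solve 4 (λ a b p r → a :* (b :+ p :* r) := a :* b :+ p :* (a :* r)) refl
                               (ind (c i ≟ᶠ p)) (weight l i) (2 ^ l) (r i)) ⟩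
  Σ< m (λ i → ind (c i ≟ᶠ p) * weight l i + 2 ^ l * (ind (c i ≟ᶠ p) * r i))
    ≡⟨ Σ<-+ m (λ i → ind (c i ≟ᶠ p) * weight l i) (λ i → 2 ^ l * (ind (c i ≟ᶠ p) * r i)) ⟩
  weightOn l m c p + Σ< m (λ i → 2 ^ l * (ind (c i ≟ᶠ p) * r i))
    ≡⟨ cong (weightOn l m c p +_) (Σ<-*ˡ m (2 ^ l) (λ i → ind (c i ≟ᶠ p) * r i)) ⟩
  weightOn l m c p + 2 ^ l * largeOn (suc l) m c p ∎
  where
  open ≡-Reasoning
  open +-*-Solver
  r : ℕ → ℕ
  r i = ind (tri (suc l) ≤? i)

weightOn≥largeOn : ∀ l m (c : Conf k) p → 2 ^ l * largeOn l m c p ≤ weightOn l m c p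
weightOn≥largeOn l m c p = ≤-trans (≤-reflexive (sym (Σ<-*ˡ m (2 ^ l) (λ i → ind (c i ≟ᶠ p) * ind (tri l ≤? i)))))
                      (Σ<-mono m (λ {i} _ → le i))
  where
  open ≤-Reasoning
  le : ∀ i → 2 ^ l * (ind (c i ≟ᶠ p) * ind (tri l ≤? i)) ≤ ind (c i ≟ᶠ p) * weight l i
  le i with tri l ≤? i
  ... | yes t≤i rewrite weight-large l t≤i | *-identityʳ (ind (c i ≟ᶠ p)) = ≤-reflexive (*-comm (2 ^ l) _)
  ... | no _    rewrite *-zeroʳ (ind (c i ≟ᶠ p)) | *-zeroʳ (2 ^ l) = z≤n

weightOn-two : ∀ l m (c : Conf k) p q → (∀ {i} → i < m → c i ≡ p ⊎ c i ≡ q) → totalWeight l m ≤ weightOn l m c p + weightOn l m c q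
weightOn-two l m c p q on = ≤-trans (Σ<-mono m le) (≤-reflexive (Σ<-+ m _ _))
  where
  le : ∀ {i} → i < m → weight l i ≤ ind (c i ≟ᶠ p) * weight l i + ind (c i ≟ᶠ q) * weight l i
  le {i} i<m with on i<m
  ... | inj₁ e rewrite ind-yes (c i ≟ᶠ p) e | +-identityʳ (weight l i) = m≤m+n _ _
  ... | inj₂ e rewrite ind-yes (c i ≟ᶠ q) e | +-identityʳ (weight l i) = m≤n+m _ _

largeOn-bound : ∀ l r (c : Conf k) p → largeOn l (tri l + r) c p ≤ r
largeOn-bound l zero c p = ≤-reflexive (trans (cong (λ m → largeOn l m c p) (+-identityʳ (tri l))) (none (tri l) ≤-refl))
  where
  none : ∀ m → m ≤ tri l → largeOn l m c p ≡ 0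
  none zero    _  = refl
  none (suc m) le rewrite none m (<⇒≤ le) | ind-no (tri l ≤? m) (<⇒≱ le) = *-zeroʳ (ind (c m ≟ᶠ p))
largeOn-bound l (suc r) c p rewrite +-suc (tri l) r =
  ≤-trans (+-mono-≤ (largeOn-bound l r c p) (*-mono-≤ (ind≤1 (c (tri l + r) ≟ᶠ p)) (ind≤1 (tri l ≤? tri l + r))))
          (≤-reflexive (+-comm r 1))

-- The disks below `tri (suc l)` already weigh `offset (suc l)`, and each later one, in particular
-- each later one on `p`, adds 2 ^ l.
totalWeight≥ : ∀ l {m} (c : Conf k) p → tri (suc l) ≤ m → offset (suc l) + 2 ^ l * largeOn (suc l) m c p ≤ totalWeight l m
totalWeight≥ l {m} c p le with m≤n⇒∃[o]m+o≡n le
... | r , refl = begin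
  offset (suc l) + 2 ^ l * largeOn (suc l) (tri (suc l) + r) c p
    ≤⟨ +-monoʳ-≤ (offset (suc l)) (*-monoʳ-≤ (2 ^ l) (largeOn-bound (suc l) r c p)) ⟩
  offset (suc l) + 2 ^ l * r                         ≡⟨ cong (_+ 2 ^ l * r) (totalWeight-tri l) ⟨
  totalWeight l (tri (suc l)) + 2 ^ l * r
    ≡⟨ cong (_+ 2 ^ l * r) (trans (cong (totalWeight l) (+-comm (suc l) (tri l))) (totalWeight-+ l (suc l))) ⟩
  totalWeight l (tri l) + 2 ^ l * suc l + 2 ^ l * r
    ≡⟨ solve 4 (λ a p x r → a :+ p :* x :+ p :* r := a :+ p :* (x :+ r)) refl (totalWeight l (tri l)) (2 ^ l) (suc l) r ⟩
  totalWeight l (tri l) + 2 ^ l * (suc l + r)              ≡⟨ totalWeight-+ l (suc l + r) ⟨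
  totalWeight l (tri l + (suc l + r))
    ≡⟨ cong (totalWeight l) (trans (sym (+-assoc (tri l) (suc l) r)) (cong (_+ r) (+-comm (tri l) (suc l)))) ⟩
  totalWeight l (tri (suc l) + r) ∎
  where
  open ≤-Reasoning
  open +-*-Solver

-- The lower bound

below : ℕ → ℕ → ℕ
below m d = ind (d <? m)

-- For the best l, the difference weightOn l m u p - offset l is Bousch's Ψ of
-- the set of disks that u has on p.
LowerBound : ℕ → Set
LowerBound m = ∀ {n} l {p q : Fin 4} → p ≢ q → ∀ {u v} (π : Path n u v) →
          (∀ {i} → i < m → v i ≢ p × v i ≢ q) → weightOn l m u p ≤ cost (below m) π + offset l

record FirstAndLastMove {n : ℕ} (K : ℕ) {u z : Conf 4} (π : Path n u z) : Set where
  field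
    {t y}  : Conf 4
    α      : Path n u t
    μ      : Path n t y
    -- reversed, so that the lower bound applies to the disks that z has on z K
    γ      : Path n z y
    cost≡  : ∀ f → cost f π ≡ cost f α + (cost f μ + cost f γ)
    μ≥     : ∀ f → f K ≤ cost f μ
    a b    : Fin 4
    a≢     : a ≢ u K
    b≢     : b ≢ z K
    free-t : ∀ {i} → i < K → t i ≢ u K × t i ≢ a
    free-y : ∀ {i} → i < K → y i ≢ z K × y i ≢ b
    still-α : All-steps (λ s → disk s ≢ K) α
    still-γ : All-steps (λ s → disk s ≢ K) γ

-- Right after `t` and right before `y` the disk `K` moves, so at both states the smaller disks are
-- confined to two pegs and `LowerBound K` applies to `α` and to `γ`.
first-and-last-move : ∀ K {u z : Conf 4} (π : Path n u z) → u K ≢ z K → FirstAndLastMove K π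
first-and-last-move K {u} {z} π ne = record
  { α = A.before ; μ = flip B.after ; γ = B.before
  ; cost≡ = λ f → trans (A.cost≡ f) (cong (cost f A.before +_)
      (trans (sym (cost-flip f A.after)) (trans (B.cost≡ f)
        (trans (+-comm (cost f B.before) _) (cong (_+ cost f B.before) (sym (cost-flip f B.after)))))))
  ; μ≥ = λ f → ≤-trans (B.after≥ f) (≤-reflexive (sym (cost-flip f B.after)))
  ; a = A.target ; b = B.target ; a≢ = A.target≢ ; b≢ = B.target≢
  ; free-t = A.free ; free-y = B.free
  ; still-α = A.still ; still-γ = B.still
  }
  where
  module A = FirstMove (first-move K π ne)
  -- The last move of `K` is its first move in the reversed remainder. It exists because `K` has not
  -- left `u K` before that remainder.
  module B = FirstMove (first-move K (flip A.after) (λ eq → ne (trans (sym (unmoved A.before A.still)) (sym eq))))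

-- A moment at which the `K` smallest disks have vacated `x` and a second peg, so that the lower
-- bound applies to the play up to it.
record Touched {n : ℕ} (K : ℕ) (x : Fin 4) {u v : Conf 4} (π : Path n u v) : Set where
  field
    {mid}  : Conf 4
    prefix : Path n u mid
    cost≤  : ∀ f → cost f prefix ≤ cost f π
    peg    : Fin 4
    x≢peg  : x ≢ peg
    free   : ∀ {i} → i < K → mid i ≢ x × mid i ≢ peg

module _ (x : Fin 4) (mem : ℕ → Set) (mem? : ∀ d → Dec (mem d)) where
  open ThreePegs x mem mem?

  -- A member moving from or to `x` is not smaller than `K`, so just before such a move both of its
  -- pegs are free of the disks below `K`. Without such a move the members never use `x`.
  touch : ∀ {K m} → (∀ {d} → mem d → K ≤ d) → {u v : Conf 4} (π : Path n u v) →
          All-steps (OffStep m) π ⊎ Touched K x π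
  touch ge (stay e) = inj₁ tt
  touch {K = K} {m} ge {u} (_then_ {c′ = c} s π) with touch {m = m} ge π
  ... | inj₂ T = inj₂ (record
      { prefix = s then T.prefix ; cost≤ = λ f → +-monoʳ-≤ (f (disk s)) (T.cost≤ f)
      ; peg = T.peg ; x≢peg = T.x≢peg ; free = T.free })
    where module T = Touched T
  ... | inj₁ off with mem? (disk s)
  ...   | no ¬m = inj₁ ((λ _ mm → contradiction mm ¬m) , off)
  ...   | yes mm with u (disk s) ≟ᶠ x
  ...     | yes refl = inj₂ (record
      { prefix = stay (λ _ → refl) ; cost≤ = λ f → z≤n ; peg = c (disk s) ; x≢peg = moves s
      ; free = λ i<K → clear s (<-≤-trans i<K (ge mm)) })
  ...     | no ne with c (disk s) ≟ᶠ x
  ...       | yes refl = inj₂ (record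
      { prefix = stay (λ _ → refl) ; cost≤ = λ f → z≤n ; peg = u (disk s) ; x≢peg = ≢-sym (moves s)
      ; free = λ i<K → let a , b = clear s (<-≤-trans i<K (ge mm)) in b , a })
  ...       | no ne′ = inj₁ ((λ _ _ → ne , ne′) , off)

module Members (u : Conf 4) (p : Fin 4) (lo : ℕ) where
  mem : ℕ → Set
  mem d = lo ≤ d × u d ≡ p
  mem? : ∀ d → Dec (mem d)
  mem? d = (lo ≤? d) ×-dec (u d ≟ᶠ p)

-- `H₁` is the game of `K` together with the larger disks that start on `p₀`, up to the last move of
-- `K`; `H₂` is the game of those larger disks afterwards, while `K` rests on `p₂`.
module TwoPhases (u : Conf 4) (p₀ : Fin 4) (K : ℕ) (uK : u K ≡ p₀) (x p₂ : Fin 4) where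
  module M₁ = Members u p₀ K
  module M₂ = Members u p₀ (suc K)
  module H₁ = ThreePegs x M₁.mem M₁.mem?
  module H₂ = ThreePegs p₂ M₂.mem M₂.mem?

  rank-none : ∀ m → m ≤ suc K → H₂.rank m ≡ 0
  rank-none zero    _  = refl
  rank-none (suc m) le = trans (cong₂ _+_ (rank-none m (<⇒≤ le))
    (ind-no (M₂.mem? m) (λ (h , _) → <⇒≱ h (s≤s⁻¹ le)))) refl

  rank-below : ∀ m → m ≤ K → H₁.rank m ≡ 0
  rank-below zero    _  = refl
  rank-below (suc m) le = trans (cong₂ _+_ (rank-below m (<⇒≤ le))
    (ind-no (M₁.mem? m) (λ (h , _) → <⇒≱ le h))) refl

  rank-suc : ∀ m → K < m → H₁.rank m ≡ suc (H₂.rank m)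
  rank-suc (suc m) K<m with <-cmp K m
  ... | tri> _ _ m<K = contradiction m<K (≤⇒≯ (s≤s⁻¹ K<m))
  ... | tri≈ _ refl _ = trans (cong₂ _+_ (rank-below K ≤-refl) (ind-yes (M₁.mem? K) (≤-refl , uK)))
                              (cong suc (sym (rank-none (suc K) ≤-refl)))
  ... | tri< K<m′ _ _ = cong₂ _+_ (rank-suc m K<m′)
      (≤-antisym (ind-mono (M₁.mem? m) (M₂.mem? m) (λ (_ , e) → K<m′ , e))
                 (ind-mono (M₂.mem? m) (M₁.mem? m) (λ (h , e) → <⇒≤ h , e)))

  module _ (y : Conf 4) (yK : y K ≢ p₀) where
    -- Induction from the largest member down. If it has left `p₀` at `y`, the first phase alone
    -- pays the claim, as `H₁` has one member more. Otherwise the second phase pays half of the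
    -- claim for taking it off `p₀`, and the induction hypothesis with a new goal, again different
    -- from `p₀`, gives the other half.
    two-phases : ∀ m g → K < m → g ≢ p₀ →
                 2 ^ H₂.rank m ≤ H₁.potential p₀ m y + H₂.potential g m y
    two-phases (suc m) g K<m g≢ with <-cmp K m
    ... | tri> _ _ m<K = contradiction m<K (≤⇒≯ (s≤s⁻¹ K<m))
    -- No larger member is left, and the departure of `K` from `p₀` pays the 1.
    ... | tri≈ _ refl _ = begin
      2 ^ H₂.rank (suc K)                               ≡⟨ cong (2 ^_) (rank-none (suc K) ≤-refl) ⟩
      1                                                 ≤⟨ m^n>0 2 (H₁.rank K) ⟩
      2 ^ H₁.rank K                                     ≤⟨ m≤m+n _ _ ⟩
      2 ^ H₁.rank K + H₁.potential (H₁.third (y K) p₀) K y ≡⟨ H₁.potential-away p₀ K (≤-refl , uK) yK ⟨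
      H₁.potential p₀ (suc K) y                         ≤⟨ m≤m+n _ _ ⟩
      H₁.potential p₀ (suc K) y + H₂.potential g (suc K) y ∎
      where open ≤-Reasoning
    ... | tri< K<m′ _ _ = go (u m ≟ᶠ p₀) (y m ≟ᶠ p₀)
      where
      open ≤-Reasoning
      go : Dec (u m ≡ p₀) → Dec (y m ≡ p₀) →
           2 ^ H₂.rank (suc m) ≤ H₁.potential p₀ (suc m) y + H₂.potential g (suc m) y
      go (no ne) _ = begin
        2 ^ (H₂.rank m + ind (M₂.mem? m)) ≡⟨ cong (λ a → 2 ^ (H₂.rank m + a)) (ind-no (M₂.mem? m) (λ (_ , e) → ne e)) ⟩
        2 ^ (H₂.rank m + 0)               ≡⟨ cong (2 ^_) (+-identityʳ (H₂.rank m)) ⟩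
        2 ^ H₂.rank m                     ≤⟨ two-phases m g K<m′ g≢ ⟩
        H₁.potential p₀ m y + H₂.potential g m y
          ≡⟨ cong₂ _+_ (H₁.potential-nonMember p₀ m (λ (_ , e) → ne e)) (H₂.potential-nonMember g m (λ (_ , e) → ne e)) ⟨
        H₁.potential p₀ (suc m) y + H₂.potential g (suc m) y ∎
      go (yes e) d = begin
        2 ^ (H₂.rank m + ind (M₂.mem? m)) ≡⟨ cong (λ a → 2 ^ (H₂.rank m + a)) (ind-yes (M₂.mem? m) (K<m′ , e)) ⟩
        2 ^ (H₂.rank m + 1)               ≡⟨ cong (2 ^_) (+-comm (H₂.rank m) 1) ⟩
        2 ^ suc (H₂.rank m)               ≤⟨ top d ⟩
        H₁.potential p₀ (suc m) y + H₂.potential g (suc m) y ∎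
        where
        top : Dec (y m ≡ p₀) → 2 ^ suc (H₂.rank m) ≤ H₁.potential p₀ (suc m) y + H₂.potential g (suc m) y
        top (no ne) = begin
          2 ^ suc (H₂.rank m) ≡⟨ cong (2 ^_) (rank-suc m K<m′) ⟨
          2 ^ H₁.rank m       ≤⟨ m≤m+n _ _ ⟩
          2 ^ H₁.rank m + H₁.potential (H₁.third (y m) p₀) m y ≡⟨ H₁.potential-away p₀ m (<⇒≤ K<m′ , e) ne ⟨
          H₁.potential p₀ (suc m) y ≤⟨ m≤m+n _ _ ⟩
          H₁.potential p₀ (suc m) y + H₂.potential g (suc m) y ∎
        top (yes at) = begin
          2 ^ suc (H₂.rank m)             ≡⟨ cong (2 ^ H₂.rank m +_) (+-identityʳ _) ⟩
          2 ^ H₂.rank m + 2 ^ H₂.rank m   ≤⟨ +-monoʳ-≤ (2 ^ H₂.rank m) (two-phases m g′ K<m′ g′≢) ⟩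
          2 ^ H₂.rank m + (H₁.potential p₀ m y + H₂.potential g′ m y)
            ≡⟨ solve 3 (λ a b c → a :+ (b :+ c) := b :+ (a :+ c)) refl (2 ^ H₂.rank m) (H₁.potential p₀ m y) (H₂.potential g′ m y) ⟩
          H₁.potential p₀ m y + (2 ^ H₂.rank m + H₂.potential g′ m y)
            ≡⟨ cong₂ _+_ (H₁.potential-there p₀ m (<⇒≤ K<m′ , e) at)
                         (H₂.potential-away g m (K<m′ , e) (λ eq → g≢ (trans (sym eq) at))) ⟨
          H₁.potential p₀ (suc m) y + H₂.potential g (suc m) y ∎
          where
          open +-*-Solver
          g′ = H₂.third (y m) g
          g′≢ : g′ ≢ p₀
          g′≢ eq = H₂.third≢ˡ (y m) g (trans eq (sym at))

-- The moves before, between and after those of `K`.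

Distinct : (p q r s : Fin 4) → Set
Distinct p q r s = p ≢ q × r ≢ p × r ≢ q × s ≢ p × s ≢ q × s ≢ r

other-two : ∀ {p q r s} → Distinct p q r s → ∀ i → i ≢ p → i ≢ q → i ≡ r ⊎ i ≡ s
other-two {r = r} (q≢p , r≢p , r≢q , s≢p , s≢q , s≢r) i i≢p i≢q with i ≟ᶠ r
... | yes i≡r = inj₁ i≡r
... | no i≢r  = inj₂ (one-of-four _ _ _ _ q≢p r≢p r≢q s≢p s≢q s≢r i i≢p i≢q i≢r)

below-mono : ∀ {K N} → K ≤ N → ∀ d → below K d ≤ below N d
below-mono {K} {N} K≤N d = ind-mono (d <? K) (d <? N) (λ d<K → <-≤-trans d<K K≤N)

-- A larger disk can neither leave nor reach the peg on which `K` rests.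
still-off : ∀ {K N p} {mem : ℕ → Set} (mem? : ∀ d → Dec (mem d)) → (∀ {d} → mem d → K < d) →
            {u v : Conf 4} (π : Path n u v) → All-steps (λ s → disk s ≢ K) π → u K ≡ p →
            All-steps (ThreePegs.OffStep p mem mem? N) π
still-off mem? gt (stay e) _ _ = tt
still-off mem? gt (s then π) (ne , nes) uK =
  (λ _ mm → (λ eq → proj₁ (clear s (gt mm)) (trans uK (sym eq)))
          , (λ eq → proj₂ (clear s (gt mm)) (trans uK (sym eq))))
  , still-off mem? gt π nes (trans (rest s (≢-sym ne)) uK)

-- `a` and `b` stand for the moves of the disks below `K` before its first and after its last move.
-- The remaining moves contribute at least 1, and at least 2 ^ l in the situation of `special`.
record Stage {n : ℕ} (K N : ℕ) {u z : Conf 4} (p₀ p₂ : Fin 4) (π : Path n u z) : Set where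
  field
    a b     : ℕ
    start   : ∀ l → weightOn l K u p₀ ≤ a + offset l
    end     : ∀ l → weightOn l K z p₂ ≤ b + offset l
    total   : a + 1 + b ≤ cost (below N) π
    special : ∀ l {q r} → Distinct p₀ p₂ q r → tri (suc l) ≤ K →
              (∀ {d} → K < d → d < N → u d ≡ p₀ → z d ≡ q) →
              Σ< N (λ d → ind (Members.mem? u p₀ (suc K) d)) ≡ l →
              a + 2 ^ l + b ≤ cost (below N) π

stage-of : ∀ {K N p₀ p₂} {u z : Conf 4} → LowerBound K → K < N → (π : Path n u z) →
         p₂ ≢ p₀ → u K ≡ p₀ → z K ≡ p₂ → Stage K N p₀ p₂ π
stage-of {n = n} {K = K} {N} {p₀} {p₂} {u} {z} lower-bound K<N π p₂≢p₀ refl refl = record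
  { a = cost (below K) P.α
  ; b = cost (below K) P.γ
  ; start = λ l → lower-bound l (≢-sym P.a≢) P.α P.free-t
  ; end = λ l → lower-bound l (≢-sym P.b≢) P.γ P.free-y
  ; total = assemble 1 0 (≤-trans (≤-reflexive (sym (ind-yes (K <? N) K<N))) (P.μ≥ (below N)))
              (≤-trans (≤-reflexive (+-identityʳ _)) (cost-mono (below-mono (<⇒≤ K<N)) P.γ)) ≤-refl
  ; special = special
  }
  where
  module P = FirstAndLastMove (first-and-last-move K π (≢-sym p₂≢p₀))
  -- `x` bounds the moves between `t` and `y` from below, and the number `y` those moves in `γ` that
  -- are made by disks from `K` on.
  assemble : ∀ x y {m} → x ≤ cost (below N) P.μ → cost (below K) P.γ + y ≤ cost (below N) P.γ →
             m ≤ x + y → cost (below K) P.α + m + cost (below K) P.γ ≤ cost (below N) π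
  assemble x y {m} hx hy hm = begin
    cost (below K) P.α + m + cost (below K) P.γ
      ≤⟨ +-monoˡ-≤ (cost (below K) P.γ) (+-monoʳ-≤ (cost (below K) P.α) hm) ⟩
    cost (below K) P.α + (x + y) + cost (below K) P.γ
      ≡⟨ solve 4 (λ a x y b → a :+ (x :+ y) :+ b := a :+ (x :+ (b :+ y))) refl (cost (below K) P.α) x y (cost (below K) P.γ) ⟩
    cost (below K) P.α + (x + (cost (below K) P.γ + y))
      ≤⟨ +-mono-≤ (cost-mono (below-mono (<⇒≤ K<N)) P.α) (+-mono-≤ hx hy) ⟩
    cost (below N) P.α + (cost (below N) P.μ + cost (below N) P.γ)
      ≡⟨ P.cost≡ (below N) ⟨
    cost (below N) π ∎
    where
    open ≤-Reasoning
    open +-*-Solver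
  module M₁ = Members u p₀ K
  module M₂ = Members u p₀ (suc K)
  w₁ w₂ : ℕ → ℕ
  w₁ d = ind (M₁.mem? d ×-dec d <? N)
  w₂ d = ind (M₂.mem? d ×-dec d <? N)
  μ-both : cost (below K) P.μ + cost w₁ P.μ ≤ cost (below N) P.μ
  μ-both = ≤-trans (≤-reflexive (sym (cost-+ (below K) w₁ P.μ)))
    (cost-mono (λ d → ind-disjoint (d <? K) (M₁.mem? d ×-dec d <? N) (d <? N)
      (λ d<K → <-trans d<K K<N) proj₂ (λ d<K ((K≤d , _) , _) → <⇒≱ d<K K≤d)) P.μ)
  γ-both : cost (below K) P.γ + cost w₂ P.γ ≤ cost (below N) P.γ
  γ-both = ≤-trans (≤-reflexive (sym (cost-+ (below K) w₂ P.γ)))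
    (cost-mono (λ d → ind-disjoint (d <? K) (M₂.mem? d ×-dec d <? N) (d <? N)
      (λ d<K → <-trans d<K K<N) proj₂ (λ d<K ((K≤d , _) , _) → <⇒≱ (m<n⇒m<1+n d<K) K≤d)) P.γ)
  at-t : ∀ {d} → M₁.mem d → P.t d ≡ p₀
  at-t {d} (K≤d , e) with m≤n⇒m<n∨m≡n K≤d
  ... | inj₁ K<d  = disks-below-held P.α P.still-α K<d refl e
  ... | inj₂ refl = unmoved P.α P.still-α
  y-K : P.y K ≡ p₂
  y-K = unmoved P.γ P.still-γ

  module _ (l : ℕ) {q r : Fin 4} (dist : Distinct p₀ p₂ q r) (tri≤K : tri (suc l) ≤ K)
           (onq : ∀ {d} → K < d → d < N → u d ≡ p₀ → z d ≡ q)
           (count : Σ< N (λ d → ind (M₂.mem? d)) ≡ l) where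
    q≢p₀ : q ≢ p₀
    q≢p₀ = proj₁ (proj₂ dist)
    q≢p₂ : q ≢ p₂
    q≢p₂ = proj₁ (proj₂ (proj₂ dist))
    r≢p₀ : r ≢ p₀
    r≢p₀ = proj₁ (proj₂ (proj₂ (proj₂ dist)))

    -- Both phases are three-peg games: `μ` avoids `x`, and `γ` avoids the resting place `p₂` of
    -- `K`. The potentials vanish at `t` and at `z`, where the members stand on `p₀` and on `q`, so
    -- their values at `y` bound the moves made.
    untouched : ∀ x → x ≢ p₀ → All-steps (ThreePegs.OffStep x M₁.mem M₁.mem? N) P.μ →
                cost (below K) P.α + 2 ^ l + cost (below K) P.γ ≤ cost (below N) π
    untouched x x≢p₀ off = assemble (cost w₁ P.μ) (cost w₂ P.γ) (m+n≤o⇒n≤o _ μ-both) γ-both (begin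
      2 ^ l               ≡⟨ cong (2 ^_) count ⟨
      2 ^ T.H₂.rank N     ≤⟨ T.two-phases P.y (λ eq → p₂≢p₀ (trans (sym y-K) eq)) N q K<N q≢p₀ ⟩
      T.H₁.potential p₀ N P.y + T.H₂.potential q N P.y
        ≤⟨ +-mono-≤ (T.H₁.potential-path p₀ N (≢-sym x≢p₀) P.μ off
                       (λ _ mm eq → x≢p₀ (trans (sym eq) (at-t mm))))
                    (T.H₂.potential-path q N q≢p₂ P.γ
                       (still-off M₂.mem? proj₁ P.γ P.still-γ refl)
                       (λ d<N (K<d , e) eq → q≢p₂ (trans (sym (onq K<d d<N e)) eq))) ⟩
      (cost w₁ P.μ + T.H₁.potential p₀ N P.t) + (cost w₂ P.γ + T.H₂.potential q N z)
        ≡⟨ cong₂ (λ a b → (cost w₁ P.μ + a) + (cost w₂ P.γ + b))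
             (T.H₁.potential-goal p₀ N (λ _ mm → at-t mm))
             (T.H₂.potential-goal q N (λ d<N (K<d , e) → onq K<d d<N e)) ⟩
      (cost w₁ P.μ + 0) + (cost w₂ P.γ + 0)
        ≡⟨ cong₂ _+_ (+-identityʳ (cost w₁ P.μ)) (+-identityʳ (cost w₂ P.γ)) ⟩
      cost w₁ P.μ + cost w₂ P.γ ∎)
      where
      open ≤-Reasoning
      module T = TwoPhases u p₀ K refl x p₂

    Clears : Fin 4 → Set
    Clears x = weightOn l K P.t x ≤ cost (below K) P.μ + offset l

    clears : ∀ {x} → Touched K x P.μ → Clears x
    clears T = ≤-trans (lower-bound l T.x≢peg T.prefix T.free) (+-monoˡ-≤ (offset l) (T.cost≤ (below K)))
      where module T = Touched T

    -- At `t` the disks below `K` stand on `x` and `y` and weigh at least `offset (suc l)` together;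
    -- vacating either peg costs its weight minus `offset l`. So twice the cost is at least 2 ^ (l +
    -- 1) - 1, and rounding up does the rest.
    two : ∀ x y → (∀ i → i ≢ p₀ → i ≢ P.a → i ≡ x ⊎ i ≡ y) → Clears x → Clears y →
          2 ^ l ≤ 1 + cost (below K) P.μ
    two x y split cx cy = *-cancelˡ-≤ 2 (begin
      2 * 2 ^ l
        ≤⟨ +-cancelʳ-≤ (2 ^ l * l + offset l) _ _ (begin
             2 * 2 ^ l + (2 ^ l * l + offset l)
               ≡⟨ solve 3 (λ p l c → con 2 :* p :+ (p :* l :+ c) := c :+ p :* (con 1 :+ l) :+ p) refl (2 ^ l) l (offset l) ⟩
             offset (suc l) + 2 ^ l
               ≤⟨ +-monoˡ-≤ (2 ^ l) (m+n≤o⇒m≤o (offset (suc l)) (totalWeight≥ l P.t p₀ tri≤K)) ⟩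
             totalWeight l K + 2 ^ l
               ≤⟨ +-monoˡ-≤ (2 ^ l) (weightOn-two l K P.t x y (λ i<K → split _ (proj₁ (P.free-t i<K)) (proj₂ (P.free-t i<K)))) ⟩
             weightOn l K P.t x + weightOn l K P.t y + 2 ^ l
               ≤⟨ +-monoˡ-≤ (2 ^ l) (+-mono-≤ cx cy) ⟩
             (m + offset l) + (m + offset l) + 2 ^ l
               ≡⟨ solve 3 (λ m c p → (m :+ c) :+ (m :+ c) :+ p := con 2 :* m :+ c :+ (c :+ p)) refl m (offset l) (2 ^ l) ⟩
             2 * m + offset l + (offset l + 2 ^ l)
               ≡⟨ cong (2 * m + offset l +_) (offset-closed l) ⟩
             2 * m + offset l + (2 ^ l * l + 1)
               ≡⟨ solve 3 (λ m c p → con 2 :* m :+ c :+ (p :+ con 1) := (con 1 :+ con 2 :* m) :+ (p :+ c)) refl m (offset l) (2 ^ l * l) ⟩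
             (1 + 2 * m) + (2 ^ l * l + offset l) ∎) ⟩
      1 + 2 * m ≤⟨ n≤1+n _ ⟩
      2 + 2 * m ≡⟨ *-suc 2 m ⟨
      2 * (1 + m) ∎)
      where
      open ≤-Reasoning
      open +-*-Solver
      m = cost (below K) P.μ

    -- When every peg is vacated by the K smallest disks between t and y, they
    -- pay for the larger one of their two stacks at t.
    all-touched : Touched K q P.μ → Touched K r P.μ → 2 ^ l ≤ 1 + cost (below K) P.μ
    all-touched Tq Tr with P.a ≟ᶠ p₂ | P.a ≟ᶠ q
    ... | yes e | _ = two q r (λ i i≢p₀ i≢a → other-two dist i i≢p₀ (λ eq → i≢a (trans eq (sym e)))) (clears Tq) (clears Tr)
    ... | no _ | yes e = two p₂ r split clears-p₂ (clears Tr)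
      where
      -- `K` arrives on `p₂` with its last move, so the smaller disks have vacated `p₂` by the end
      -- of `μ`.
      clears-p₂ : Clears p₂
      clears-p₂ = lower-bound l (≢-sym P.b≢) P.μ P.free-y
      split : ∀ i → i ≢ p₀ → i ≢ P.a → i ≡ p₂ ⊎ i ≡ r
      split i i≢p₀ i≢a with i ≟ᶠ p₂
      ... | yes i≡p₂ = inj₁ i≡p₂
      ... | no i≢p₂  = let d₁ , d₂ , d₃ , d₄ , d₅ , d₆ = dist
                       in inj₂ (one-of-four p₀ p₂ q r d₁ d₂ d₃ d₄ d₅ d₆ i i≢p₀ i≢p₂ (λ eq → i≢a (trans eq (sym e))))
    ... | no a≢p₂ | no a≢q = two p₂ q split clears-p₂ (clears Tq)
      where
      clears-p₂ : Clears p₂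
      clears-p₂ = lower-bound l (≢-sym P.b≢) P.μ P.free-y
      a≡r : P.a ≡ r
      a≡r = let d₁ , d₂ , d₃ , d₄ , d₅ , d₆ = dist
            in one-of-four p₀ p₂ q r d₁ d₂ d₃ d₄ d₅ d₆ P.a P.a≢ a≢p₂ a≢q
      split : ∀ i → i ≢ p₀ → i ≢ P.a → i ≡ p₂ ⊎ i ≡ q
      split i i≢p₀ i≢a with i ≟ᶠ p₂ | i ≟ᶠ q
      ... | yes i≡p₂ | _ = inj₁ i≡p₂
      ... | no _ | yes i≡q = inj₂ i≡q
      ... | no i≢p₂ | no i≢q = let d₁ , d₂ , d₃ , d₄ , d₅ , d₆ = dist
        in contradiction (trans (one-of-four p₀ p₂ q r d₁ d₂ d₃ d₄ d₅ d₆ i i≢p₀ i≢p₂ i≢q) (sym a≡r)) i≢a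

    special : cost (below K) P.α + 2 ^ l + cost (below K) P.γ ≤ cost (below N) π
    special with touch q M₁.mem M₁.mem? {K = K} {m = N} proj₁ P.μ | touch r M₁.mem M₁.mem? {K = K} {m = N} proj₁ P.μ
    ... | inj₁ off | _        = untouched q q≢p₀ off
    ... | inj₂ _   | inj₁ off = untouched r r≢p₀ off
    -- The disks below `K` pay 2 ^ l - 1 during `μ`, and a move of `K` itself is the missing one.
    ... | inj₂ Tq  | inj₂ Tr  =
      assemble (cost (below K) P.μ + cost w₁ P.μ) 0 μ-both
        (≤-trans (≤-reflexive (+-identityʳ _)) (cost-mono (below-mono (<⇒≤ K<N)) P.γ))
        (begin
          2 ^ l                               ≤⟨ all-touched Tq Tr ⟩
          1 + cost (below K) P.μ              ≡⟨ +-comm 1 _ ⟩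
          cost (below K) P.μ + 1              ≤⟨ +-monoʳ-≤ (cost (below K) P.μ) 1≤ ⟩
          cost (below K) P.μ + cost w₁ P.μ    ≡⟨ +-identityʳ _ ⟨
          cost (below K) P.μ + cost w₁ P.μ + 0 ∎)
      where
      open ≤-Reasoning
      1≤ : 1 ≤ cost w₁ P.μ
      1≤ = ≤-trans (≤-reflexive (sym (ind-yes (M₁.mem? K ×-dec K <? N) ((≤-refl , refl) , K<N)))) (P.μ≥ w₁)

-- The search for `K` among the large disks.

weightOn-at : ∀ l N (c : Conf k) {p} → tri l ≤ N → c N ≡ p → weightOn l (suc N) c p ≡ weightOn l N c p + 2 ^ l
weightOn-at l N c {p} t e = cong (weightOn l N c p +_)
  (trans (cong₂ _*_ (ind-yes (c N ≟ᶠ p) e) (weight-large l t)) (+-identityʳ _))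

weightOn-off : ∀ l N (c : Conf k) {p} → c N ≢ p → weightOn l (suc N) c p ≡ weightOn l N c p
weightOn-off l N c {p} ne = trans (cong (λ a → weightOn l N c p + a * weight l N) (ind-no (c N ≟ᶠ p) ne)) (+-identityʳ _)

module Search (l : ℕ) (u z : Conf 4) (p₀ q : Fin 4) where
  L = suc l

  -- `K` is the largest disk below `N` that `u` has on `p₀` and `z` does not have on `q`; `j` counts
  -- the disks between `K` and `N` that start on `p₀`.
  record Found (N r : ℕ) : Set where
    field
      K     : ℕ
      K<N   : K < N
      tri≤K : tri L ≤ K
      u-K   : u K ≡ p₀
      z-K   : z K ≢ q
      j     : ℕ
      j<r   : j < r
      sumE  : weightOn L N u p₀ ≡ weightOn L K u p₀ + suc j * 2 ^ L
      sumA  : weightOn l K z q + j * 2 ^ l ≤ weightOn l N z q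
      count : Σ< N (λ d → ind (Members.mem? u p₀ (suc K) d)) ≡ j
      on-q  : ∀ {d} → K < d → d < N → u d ≡ p₀ → z d ≡ q

  count-none : ∀ m K → m ≤ suc K → Σ< m (λ d → ind (Members.mem? u p₀ (suc K) d)) ≡ 0
  count-none zero    K _  = refl
  count-none (suc m) K le = cong₂ _+_ (count-none m K (<⇒≤ le))
    (ind-no (Members.mem? u p₀ (suc K) m) (λ (h , _) → <⇒≱ h (s≤s⁻¹ le)))

  -- Going down from `N`, each large disk that starts on `p₀` either is on `q` and lowers `r` by
  -- one, or is the `K` looked for. If `r` is used up, that many large disks are on `q`.
  find : ∀ N r → r ≤ largeOn L N u p₀ → r ≤ largeOn L N z q ⊎ Found N r
  find zero    zero _  = inj₁ z≤n
  find (suc N) r    r≤ with tri L ≤? N | u N ≟ᶠ p₀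
  find (suc N) r    r≤ | no ¬t | d
    with find N r (subst (r ≤_) (trans (cong (largeOn L N u p₀ +_) (*-zeroʳ (ind d))) (+-identityʳ _)) r≤)
  ... | inj₁ le = inj₁ (≤-trans le (m≤m+n _ _))
  ... | inj₂ F  = contradiction (≤-trans (Found.tri≤K F) (<⇒≤ (Found.K<N F))) ¬t
  find (suc N) r    r≤ | yes t | no ne
    with find N r (subst (r ≤_) (+-identityʳ _) r≤)
  ... | inj₁ le = inj₁ (≤-trans le (m≤m+n _ _))
  ... | inj₂ F  = inj₂ (record
    { K = F.K ; K<N = m<n⇒m<1+n F.K<N ; tri≤K = F.tri≤K ; u-K = F.u-K ; z-K = F.z-K
    ; j = F.j ; j<r = F.j<r
    ; sumE = trans (weightOn-off L N u ne) F.sumE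
    ; sumA = ≤-trans F.sumA (m≤m+n _ _)
    ; count = trans (cong₂ _+_ F.count (ind-no (Members.mem? u p₀ (suc F.K) N) (λ (_ , e) → ne e))) (+-identityʳ _)
    ; on-q = λ K<d d<N e → F.on-q K<d (≤∧≢⇒< (s≤s⁻¹ d<N) (λ { refl → ne e })) e })
    where module F = Found F
  find (suc N) zero    r≤ | yes t | yes e = inj₁ z≤n
  find (suc N) (suc r) r≤ | yes t | yes e with z N ≟ᶠ q
  ... | no ne = inj₂ (record
    { K = N ; K<N = ≤-refl ; tri≤K = t ; u-K = e ; z-K = ne ; j = 0 ; j<r = s≤s z≤n
    ; sumE = trans (weightOn-at L N u t e) (cong (weightOn L N u p₀ +_) (sym (*-identityˡ _)))
    ; sumA = ≤-trans (≤-reflexive (+-identityʳ _)) (m≤m+n _ _)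
    ; count = count-none (suc N) N ≤-refl
    ; on-q = λ N<d d<N → contradiction N<d (≤⇒≯ (s≤s⁻¹ d<N)) })
  ... | yes on with find N r (s≤s⁻¹ (subst (suc r ≤_) (+-comm _ 1) r≤))
  ...   | inj₁ le = inj₁ (subst (suc r ≤_) (+-comm 1 _) (s≤s le))
  ...   | inj₂ F  = inj₂ (record
    { K = F.K ; K<N = m<n⇒m<1+n F.K<N ; tri≤K = F.tri≤K ; u-K = F.u-K ; z-K = F.z-K
    ; j = suc F.j ; j<r = s≤s F.j<r
    ; sumE = begin
        weightOn L (suc N) u p₀ ≡⟨ weightOn-at L N u t e ⟩
        weightOn L N u p₀ + 2 ^ L ≡⟨ cong (_+ 2 ^ L) F.sumE ⟩
        weightOn L F.K u p₀ + suc F.j * 2 ^ L + 2 ^ L ≡⟨ +-assoc (weightOn L F.K u p₀) _ _ ⟩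
        weightOn L F.K u p₀ + (suc F.j * 2 ^ L + 2 ^ L) ≡⟨ cong (weightOn L F.K u p₀ +_) (+-comm (suc F.j * 2 ^ L) _) ⟩
        weightOn L F.K u p₀ + suc (suc F.j) * 2 ^ L ∎
    ; sumA = ≤-trans (≤-reflexive (trans (cong (weightOn l F.K z q +_) (+-comm (2 ^ l) _)) (sym (+-assoc (weightOn l F.K z q) _ _))))
               (≤-trans (+-monoˡ-≤ (2 ^ l) F.sumA)
                 (≤-reflexive (sym (weightOn-at l N z (≤-trans (m≤n+m (tri l) (suc l)) t) on))))
    ; count = trans (cong₂ _+_ F.count (ind-yes (Members.mem? u p₀ (suc F.K) N) (F.K<N , e))) (+-comm F.j 1)
    ; on-q = on-q })
    where
    module F = Found F
    open ≡-Reasoning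
    on-q : ∀ {d} → F.K < d → d < suc N → u d ≡ p₀ → z d ≡ q
    on-q {d} K<d d<N e with d ≟ N
    ... | yes refl = on
    ... | no ne    = F.on-q K<d (≤∧≢⇒< (s≤s⁻¹ d<N) ne) e

-- How the largest disk leaves the pegs `p₀` and `p₁`.

record Exit {n : ℕ} (N : ℕ) (p₀ p₁ p : Fin 4) {u v : Conf 4} (π : Path n u v) : Set where
  field
    {mid}  : Conf 4
    before : Path n u mid
    after  : Path n mid v
    cost≡  : ∀ f → cost f π ≡ cost f before + cost f after
    after≥ : ∀ f → f N ≤ cost f after
    r      : Fin 4
    r≢p₀   : r ≢ p₀
    r≢p₁   : r ≢ p₁
    free   : ∀ {i} → i < N → mid i ≢ p × mid i ≢ r

-- An exit from `p₁` after an arrival from `p₀`. At `mid` disk `N` is about to move from `p₀` to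
-- `p₁`, so both are free of smaller disks; `exit≥` records that this move precedes the exit.
record Via {n : ℕ} (N : ℕ) (p₀ p₁ : Fin 4) {u v : Conf 4} (π : Path n u v) : Set where
  field
    {mid}  : Conf 4
    prefix : Path n u mid
    suffix : Path n mid v
    cost≡  : ∀ f → cost f π ≡ cost f prefix + cost f suffix
    free   : ∀ {i} → i < N → mid i ≢ p₀ × mid i ≢ p₁
    exit   : Exit N p₀ p₁ p₁ suffix
    exit≥  : ∀ f → f N ≤ cost f (Exit.before exit)

module _ {N : ℕ} {p₀ p₁ : Fin 4} where

  extend-exit : ∀ {n p} {u c v : Conf 4} (s : Step n u c) {π : Path n c v} →
                Exit N p₀ p₁ p π → Exit N p₀ p₁ p (s then π)
  extend-exit s E = record
    { before = s then E.before ; after = E.after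
    ; cost≡ = λ f → trans (cong (f (disk s) +_) (E.cost≡ f)) (sym (+-assoc (f (disk s)) _ _))
    ; after≥ = E.after≥ ; r = E.r ; r≢p₀ = E.r≢p₀ ; r≢p₁ = E.r≢p₁ ; free = E.free }
    where module E = Exit E

  extend-via : ∀ {n} {u c v : Conf 4} (s : Step n u c) {π : Path n c v} →
               Via N p₀ p₁ π → Via N p₀ p₁ (s then π)
  extend-via s V = record
    { prefix = s then V.prefix ; suffix = V.suffix
    ; cost≡ = λ f → trans (cong (f (disk s) +_) (V.cost≡ f)) (sym (+-assoc (f (disk s)) _ _))
    ; free = V.free ; exit = V.exit ; exit≥ = V.exit≥ }
    where module V = Via V

  exit-now : ∀ {n p} {u c v : Conf 4} (s : Step n u c) (π : Path n c v) → disk s ≡ N →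
             u N ≡ p → c N ≢ p₀ → c N ≢ p₁ → Exit N p₀ p₁ p (s then π)
  exit-now s π refl refl ne₀ ne₁ = record
    { before = stay (λ _ → refl) ; after = s then π ; cost≡ = λ f → refl ; after≥ = λ f → m≤m+n (f (disk s)) _
    ; r = _ ; r≢p₀ = ne₀ ; r≢p₁ = ne₁ ; free = clear s }

  mutual
    -- Follows disk `N` while it goes back and forth between the two pegs. The second alternative of
    -- `exit₁` is an exit from `p₁` without a return to `p₀`; so `Via` is built from the last move
    -- from `p₀` to `p₁` before the exit.
    exit₀ : ∀ {n} {u v : Conf 4} (π : Path n u v) → u N ≡ p₀ → v N ≢ p₀ → v N ≢ p₁ →
            Exit N p₀ p₁ p₀ π ⊎ Via N p₀ p₁ π
    exit₀ (stay e) u-N ne₀ ne₁ = contradiction (trans (sym (e N)) u-N) ne₀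
    exit₀ {u = u} (_then_ {c′ = c} s π) u-N ne₀ ne₁ with disk s ≟ N
    ... | no ne with exit₀ π (trans (rest s (≢-sym ne)) u-N) ne₀ ne₁
    ...   | inj₁ E = inj₁ (extend-exit s E)
    ...   | inj₂ V = inj₂ (extend-via s V)
    exit₀ {u = u} (_then_ {c′ = c} s π) u-N ne₀ ne₁ | yes refl with c N ≟ᶠ p₁
    ... | no c≢p₁ = inj₁ (exit-now s π refl u-N (λ eq → moves s (trans u-N (sym eq))) c≢p₁)
    ... | yes c≡p₁ with exit₁ π c≡p₁ ne₀ ne₁
    ...   | inj₁ (inj₁ E) = inj₁ (extend-exit s E)
    ...   | inj₁ (inj₂ V) = inj₂ (extend-via s V)
    ...   | inj₂ E = inj₂ (record
      { prefix = stay (λ _ → refl) ; suffix = s then π ; cost≡ = λ f → refl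
      ; free = λ i<N → subst₂ (λ a b → u _ ≢ a × u _ ≢ b) u-N c≡p₁ (clear s i<N)
      ; exit = extend-exit s E ; exit≥ = λ f → m≤m+n (f (disk s)) _ })

    exit₁ : ∀ {n} {u v : Conf 4} (π : Path n u v) → u N ≡ p₁ → v N ≢ p₀ → v N ≢ p₁ →
            (Exit N p₀ p₁ p₀ π ⊎ Via N p₀ p₁ π) ⊎ Exit N p₀ p₁ p₁ π
    exit₁ (stay e) u-N ne₀ ne₁ = contradiction (trans (sym (e N)) u-N) ne₁
    exit₁ {u = u} (_then_ {c′ = c} s π) u-N ne₀ ne₁ with disk s ≟ N
    ... | no ne with exit₁ π (trans (rest s (≢-sym ne)) u-N) ne₀ ne₁
    ...   | inj₁ (inj₁ E) = inj₁ (inj₁ (extend-exit s E))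
    ...   | inj₁ (inj₂ V) = inj₁ (inj₂ (extend-via s V))
    ...   | inj₂ E = inj₂ (extend-exit s E)
    exit₁ {u = u} (_then_ {c′ = c} s π) u-N ne₀ ne₁ | yes refl with c N ≟ᶠ p₀
    ... | no c≢p₀ = inj₂ (exit-now s π refl u-N c≢p₀ (λ eq → moves s (trans u-N (sym eq))))
    ... | yes c≡p₀ with exit₀ π c≡p₀ ne₀ ne₁
    ...   | inj₁ E = inj₁ (inj₁ (extend-exit s E))
    ...   | inj₂ V = inj₁ (inj₂ (extend-via s V))

-- `l` disks of weight 2 ^ l exceed `offset l` by 2 ^ l - 1.
large-pays : ∀ l {s} m → 2 ^ l * l ≤ s → s ≤ m + offset l → 2 ^ l ≤ m + 1
large-pays l {s} m h₁ h₂ = +-cancelʳ-≤ (2 ^ l * l) _ _ (begin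
  2 ^ l + 2 ^ l * l    ≤⟨ +-monoʳ-≤ (2 ^ l) (≤-trans h₁ h₂) ⟩
  2 ^ l + (m + offset l)   ≡⟨ solve 3 (λ p m c → p :+ (m :+ c) := m :+ (c :+ p)) refl (2 ^ l) m (offset l) ⟩
  m + (offset l + 2 ^ l)   ≡⟨ cong (m +_) (offset-closed l) ⟩
  m + (2 ^ l * l + 1)  ≡⟨ solve 2 (λ m a → m :+ (a :+ con 1) := m :+ con 1 :+ a) refl m (2 ^ l * l) ⟩
  m + 1 + 2 ^ l * l    ∎)
  where
  open ≤-Reasoning
  open +-*-Solver

finish-large : ∀ l {s} m₁ m₃ {t} → s ≤ m₁ + offset l → 2 ^ l ≤ m₃ + 1 → m₁ + (m₃ + 1) ≤ t →
               s + 2 ^ l ≤ t + offset l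
finish-large l {s} m₁ m₃ {t} h₁ h₂ h₃ = begin
  s + 2 ^ l                  ≤⟨ +-mono-≤ h₁ h₂ ⟩
  m₁ + offset l + (m₃ + 1)       ≡⟨ solve 3 (λ a c b → a :+ c :+ b := a :+ b :+ c) refl m₁ (offset l) (m₃ + 1) ⟩
  m₁ + (m₃ + 1) + offset l       ≤⟨ +-monoˡ-≤ (offset l) h₃ ⟩
  t + offset l                   ∎
  where
  open ≤-Reasoning
  open +-*-Solver

-- `sE` is the weight below `K` that starts on `p₀`, `sA` and `sB` are the weights below `K` on the
-- two pegs in use when disk `N` leaves, `ρ` is the number of large disks behind `sE`, and `X` is
-- what the moves around `K` contribute. As `sA` and `sB` exhaust the disks below `K`, `key` charges
-- part of the weight to `m₃` and `b`; `a` and `X` cover the rest.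
finish-stage : ∀ l {sN sE sA sA′ sB tot} a b X ρ j m₃ {t} →
               sN ≡ (sE + 2 ^ l * ρ) + suc j * 2 ^ suc l → sE ≤ a + offset l →
               sA + j * 2 ^ l ≤ sA′ → sA′ ≤ m₃ + offset l → sB ≤ b + offset l →
               offset (suc l) + 2 ^ l * ρ ≤ tot → tot ≤ sA + sB →
               suc j * 2 ^ l ≤ X + l * 2 ^ l →
               a + X + b + (m₃ + 1) ≤ t → sN + 2 ^ suc l ≤ t + offset (suc l)
finish-stage l {sN} {sE} {sA} {sA′} {sB} {tot} a b X ρ j m₃ {t} eN hE hA hA′ hB hW hS hX ht = begin
  sN + 2 * P                                    ≡⟨ cong (_+ 2 * P) eN ⟩
  sE + P * ρ + suc j * (2 * P) + 2 * P          ≤⟨ +-monoˡ-≤ (2 * P) (+-monoˡ-≤ (suc j * (2 * P)) (+-monoˡ-≤ (P * ρ) hE)) ⟩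
  a + c + P * ρ + suc j * (2 * P) + 2 * P
    ≡⟨ solve 5 (λ a c p r j → a :+ c :+ p :* r :+ (con 1 :+ j) :* (con 2 :* p) :+ con 2 :* p
                 := a :+ c :+ p :+ (p :* (r :+ j :+ con 2) :+ (con 1 :+ j) :* p)) refl a c P ρ j ⟩
  a + c + P + (P * (ρ + j + 2) + suc j * P)     ≤⟨ +-monoʳ-≤ (a + c + P) (+-mono-≤ key hX) ⟩
  a + c + P + (m₃ + b + 1 + (X + l * P))
    ≡⟨ solve 7 (λ a c p m b x l → a :+ c :+ p :+ (m :+ b :+ con 1 :+ (x :+ l :* p))
                 := a :+ x :+ b :+ (m :+ con 1) :+ (c :+ p :* (con 1 :+ l))) refl a c P m₃ b X l ⟩
  a + X + b + (m₃ + 1) + offset (suc l)             ≤⟨ +-monoˡ-≤ (offset (suc l)) ht ⟩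
  t + offset (suc l) ∎
  where
  open ≤-Reasoning
  open +-*-Solver
  P = 2 ^ l
  c = offset l
  key : P * (ρ + j + 2) ≤ m₃ + b + 1
  key = +-cancelʳ-≤ (P * l + c) _ _ (begin
    P * (ρ + j + 2) + (P * l + c)
      ≡⟨ solve 5 (λ p r j l c → p :* (r :+ j :+ con 2) :+ (p :* l :+ c)
                   := c :+ p :* (con 1 :+ l) :+ p :* r :+ (j :* p :+ p)) refl P ρ j l c ⟩
    offset (suc l) + P * ρ + (j * P + P)   ≤⟨ +-monoˡ-≤ (j * P + P) (≤-trans hW hS) ⟩
    sA + sB + (j * P + P)              ≡⟨ solve 4 (λ x y z p → x :+ y :+ (z :+ p) := x :+ z :+ y :+ p) refl sA sB (j * P) P ⟩
    sA + j * P + sB + P                ≤⟨ +-monoˡ-≤ P (+-mono-≤ (≤-trans hA hA′) hB) ⟩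
    m₃ + c + (b + c) + P               ≡⟨ solve 4 (λ m c b p → m :+ c :+ (b :+ c) :+ p := m :+ b :+ c :+ (c :+ p)) refl m₃ c b P ⟩
    m₃ + b + c + (c + P)               ≡⟨ cong (m₃ + b + c +_) (offset-closed l) ⟩
    m₃ + b + c + (P * l + 1)           ≡⟨ solve 4 (λ m b c x → m :+ b :+ c :+ (x :+ con 1) := m :+ b :+ con 1 :+ (x :+ c)) refl m₃ b c (P * l) ⟩
    m₃ + b + 1 + (P * l + c)           ∎)

-- The induction step

below-suc : ∀ N {n} {u v : Conf k} (π : Path n u v) →
            cost (below N) π + cost (λ d → ind (d ≟ N)) π ≤ cost (below (suc N)) π
below-suc N π = ≤-trans (≤-reflexive (sym (cost-+ (below N) _ π)))
  (cost-mono (λ d → ind-disjoint (d <? N) (d ≟ N) (d <? suc N) m<n⇒m<1+n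
    (λ { refl → ≤-refl }) (λ { d<d refl → <-irrefl refl d<d })) π)

below-suc-moved : ∀ N {n} {u v : Conf k} (π : Path n u v) → (∀ f → f N ≤ cost f π) →
                  cost (below N) π + 1 ≤ cost (below (suc N)) π
below-suc-moved N π h = ≤-trans (+-monoʳ-≤ (cost (below N) π)
  (≤-trans (≤-reflexive (sym (ind-yes (N ≟ N) refl))) (h (λ d → ind (d ≟ N))))) (below-suc N π)

below-suc-≤ : ∀ N {n} {u v : Conf k} (π : Path n u v) → cost (below N) π ≤ cost (below (suc N)) π
below-suc-≤ N = cost-mono (below-mono (n≤1+n N))

module InductionStep (N : ℕ) (lower-bound : ∀ {m} → m < suc N → LowerBound m) (l : ℕ) {n : ℕ}
                     {p₀ p₁ : Fin 4} (p₀≢p₁ : p₀ ≢ p₁) {u v : Conf 4} (π : Path n u v)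
                     (free : ∀ {i} → i < suc N → v i ≢ p₀ × v i ≢ p₁)
                     (r≤ : suc l ≤ largeOn (suc l) N u p₀) where
  L = suc l

  free′ : ∀ {i} → i < N → v i ≢ p₀ × v i ≢ p₁
  free′ i<N = free (m<n⇒m<1+n i<N)

  large : ∀ (z : Conf 4) q m → L ≤ largeOn L N z q → weightOn L N z q ≤ m + offset L → 2 ^ L ≤ m + 1
  large z q m h hS = large-pays L m (≤-trans (*-monoʳ-≤ (2 ^ L) h) (weightOn≥largeOn L N z q)) hS

  module _ {z : Conf 4} {q : Fin 4} where
    open Search l u z p₀ q using (Found; module Found)

    -- `q` is the peg to be vacated after `z`, and `p₂` the other peg in use. For j < l a single
    -- move of `K` is enough as `X`; for j = l the larger gain of `special` is required.
    stage : ∀ {p₂ r t} (F : Found N L) (α : Path n u z) → p₂ ≢ p₀ → (∀ {i} → i < N → z i ≡ q ⊎ z i ≡ p₂) →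
            (m₃ : ℕ) → weightOn l N z q ≤ m₃ + offset l → cost (below N) α + (m₃ + 1) ≤ t →
            Found.j F < l ⊎ (Found.j F ≡ l × Distinct p₀ p₂ q r) →
            weightOn L N u p₀ + 2 ^ L ≤ t + offset L
    stage {p₂} {r} {t} F α p₂≢p₀ on m₃ hA ht = λ where
        (inj₁ j<l) → go 1 (≤-trans (*-monoˡ-≤ (2 ^ l) j<l) (m≤n+m _ 1)) G.total
        (inj₂ (refl , dist)) → go (2 ^ l) ≤-refl (G.special l dist F.tri≤K F.on-q F.count)
      where
      module F = Found F
      z-K : z F.K ≡ p₂
      z-K with on F.K<N
      ... | inj₁ e = contradiction e F.z-K
      ... | inj₂ e = e
      module G = Stage (stage-of {N = N} (lower-bound (m<n⇒m<1+n F.K<N)) F.K<N α p₂≢p₀ F.u-K z-K)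
      go : ∀ X → suc F.j * 2 ^ l ≤ X + l * 2 ^ l → G.a + X + G.b ≤ cost (below N) α →
           weightOn L N u p₀ + 2 ^ L ≤ t + offset L
      go X hX hα = finish-stage l G.a G.b X (largeOn L F.K u p₀) F.j m₃
        (trans F.sumE (cong (_+ suc F.j * 2 ^ L) (weightOn-suc l F.K u p₀)))
        (G.start l) F.sumA hA (G.end l) (totalWeight≥ l u p₀ F.tri≤K)
        (weightOn-two l F.K z q p₂ (λ i<K → on (<-trans i<K F.K<N))) hX
        (≤-trans (+-monoˡ-≤ (m₃ + 1) hα) ht)

  bound : u N ≡ p₀ → weightOn L N u p₀ + 2 ^ L ≤ cost (below (suc N)) π + offset L
  bound u-N with exit₀ {N} {p₀} {p₁} π u-N (proj₁ (free ≤-refl)) (proj₂ (free ≤-refl))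
  -- Disk `N` leaves from `p₀`: the others are on `p₁` and `p₂`, and `p₁` has to be vacated later.
  ... | inj₁ E = result
    where
    module E = Exit E
    p₂ : Fin 4
    p₂ = proj₁ (another-peg p₀ p₁ E.r)
    p₂≢p₀ : p₂ ≢ p₀
    p₂≢p₀ = proj₁ (proj₂ (another-peg p₀ p₁ E.r))
    p₂≢p₁ : p₂ ≢ p₁
    p₂≢p₁ = proj₁ (proj₂ (proj₂ (another-peg p₀ p₁ E.r)))
    p₂≢r : p₂ ≢ E.r
    p₂≢r = proj₂ (proj₂ (proj₂ (another-peg p₀ p₁ E.r)))
    m₁ = cost (below N) E.before
    m₃ = cost (below N) E.after
    on : ∀ {i} → i < N → E.mid i ≡ p₁ ⊎ E.mid i ≡ p₂
    on i<N = other-two (≢-sym E.r≢p₀ , ≢-sym p₀≢p₁ , ≢-sym E.r≢p₁ , p₂≢p₀ , p₂≢r , p₂≢p₁) _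
                    (proj₁ (E.free i<N)) (proj₂ (E.free i<N))
    total : m₁ + (m₃ + 1) ≤ cost (below (suc N)) π
    total = ≤-trans (+-mono-≤ (below-suc-≤ N E.before) (below-suc-moved N E.after E.after≥))
                    (≤-reflexive (sym (E.cost≡ (below (suc N)))))
    dist : Distinct p₀ p₂ p₁ E.r
    dist = ≢-sym p₂≢p₀ , ≢-sym p₀≢p₁ , ≢-sym p₂≢p₁ , E.r≢p₀ , ≢-sym p₂≢r , E.r≢p₁
    hA : ∀ l → weightOn l N E.mid p₁ ≤ m₃ + offset l
    hA l = lower-bound ≤-refl l (≢-sym p₀≢p₁) E.after (λ i<N → let a , b = free′ i<N in b , a)
    result : weightOn L N u p₀ + 2 ^ L ≤ cost (below (suc N)) π + offset L
    result with Search.find l u E.mid p₀ p₁ N L r≤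
    ... | inj₁ lots = finish-large L m₁ m₃ (lower-bound ≤-refl L (≢-sym E.r≢p₀) E.before E.free)
                        (large E.mid p₁ m₃ lots (hA L)) total
    ... | inj₂ F = stage F E.before p₂≢p₀ on m₃ (hA l) total (small (m≤n⇒m<n∨m≡n (s≤s⁻¹ F.j<r)))
      where
      module F = Search.Found F
      small : F.j < l ⊎ F.j ≡ l → F.j < l ⊎ (F.j ≡ l × Distinct p₀ p₂ p₁ E.r)
      small (inj₁ lt) = inj₁ lt
      small (inj₂ eq) = inj₂ (eq , dist)
  -- Disk `N` leaves from `p₁`: the others are on `p₀` and `p₂`, and `p₀` has to be vacated again.
  -- It was already empty of them at `V.mid`, so `hE` charges the whole initial weight to the
  -- prefix.
  ... | inj₂ V = result
    where
    module V = Via V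
    module E = Exit V.exit
    p₂ : Fin 4
    p₂ = proj₁ (another-peg p₀ p₁ E.r)
    p₂≢p₀ : p₂ ≢ p₀
    p₂≢p₀ = proj₁ (proj₂ (another-peg p₀ p₁ E.r))
    p₂≢p₁ : p₂ ≢ p₁
    p₂≢p₁ = proj₁ (proj₂ (proj₂ (another-peg p₀ p₁ E.r)))
    p₂≢r : p₂ ≢ E.r
    p₂≢r = proj₂ (proj₂ (proj₂ (another-peg p₀ p₁ E.r)))
    m₁ = cost (below N) V.prefix
    m₂ = cost (below N) E.before
    m₃ = cost (below N) E.after
    on : ∀ {i} → i < N → E.mid i ≡ p₀ ⊎ E.mid i ≡ p₂
    on i<N = other-two (≢-sym E.r≢p₁ , p₀≢p₁ , ≢-sym E.r≢p₀ , p₂≢p₁ , p₂≢r , p₂≢p₀) _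
                    (proj₁ (E.free i<N)) (proj₂ (E.free i<N))
    total : m₁ + ((m₂ + 1) + (m₃ + 1)) ≤ cost (below (suc N)) π
    total = ≤-trans (+-mono-≤ (below-suc-≤ N V.prefix)
                      (≤-trans (+-mono-≤ (below-suc-moved N E.before V.exit≥) (below-suc-moved N E.after E.after≥))
                               (≤-reflexive (sym (E.cost≡ (below (suc N)))))))
                    (≤-reflexive (sym (V.cost≡ (below (suc N)))))
    hE : weightOn L N u p₀ ≤ m₁ + offset L
    hE = lower-bound ≤-refl L p₀≢p₁ V.prefix V.free
    hA : ∀ l → weightOn l N E.mid p₀ ≤ m₃ + offset l
    hA l = lower-bound ≤-refl l p₀≢p₁ E.after free′
    -- Read backwards, `E.before` vacates `p₀` and `p₁`.
    hA′ : weightOn l N E.mid p₀ ≤ m₂ + offset l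
    hA′ = subst (λ x → weightOn l N E.mid p₀ ≤ x + offset l) (cost-flip (below N) E.before)
                (lower-bound ≤-refl l p₀≢p₁ (flip E.before) V.free)
    result : weightOn L N u p₀ + 2 ^ L ≤ cost (below (suc N)) π + offset L
    result with Search.find l u E.mid p₀ p₀ N L r≤
    ... | inj₁ lots = finish-large L m₁ m₃ hE (large E.mid p₀ m₃ lots (hA L))
                        (≤-trans (+-monoʳ-≤ m₁ (m≤n+m (m₃ + 1) (m₂ + 1))) total)
    ... | inj₂ F with m≤n⇒m<n∨m≡n (s≤s⁻¹ (Search.Found.j<r F))
    ...   | inj₁ j<l = stage {r = E.r} F (V.prefix ▷ E.before) p₂≢p₀ on m₃ (hA l) total′ (inj₁ j<l)
      where
      total′ : cost (below N) (V.prefix ▷ E.before) + (m₃ + 1) ≤ cost (below (suc N)) π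
      total′ = begin
        cost (below N) (V.prefix ▷ E.before) + (m₃ + 1) ≡⟨ cong (_+ (m₃ + 1)) (cost-▷ (below N) V.prefix E.before) ⟩
        m₁ + m₂ + (m₃ + 1)                              ≤⟨ +-monoˡ-≤ (m₃ + 1) (+-monoʳ-≤ m₁ (m≤m+n m₂ 1)) ⟩
        m₁ + (m₂ + 1) + (m₃ + 1)                        ≡⟨ +-assoc m₁ _ _ ⟩
        m₁ + ((m₂ + 1) + (m₃ + 1))                      ≤⟨ total ⟩
        cost (below (suc N)) π                          ∎
        where open ≤-Reasoning
    -- The `l` large disks found on `p₀` were brought there after `V.mid` and have to leave again.
    -- Each of the two costs at least 2 ^ l moves, one of disk `N` included.
    ...   | inj₂ refl = begin
        weightOn L N u p₀ + 2 ^ L                       ≤⟨ +-mono-≤ hE both ⟩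
        m₁ + offset L + ((m₂ + 1) + (m₃ + 1))        ≡⟨ solve 3 (λ a c b → a :+ c :+ b := a :+ b :+ c) refl m₁ (offset L) ((m₂ + 1) + (m₃ + 1)) ⟩
        m₁ + ((m₂ + 1) + (m₃ + 1)) + offset L        ≤⟨ +-monoˡ-≤ (offset L) total ⟩
        cost (below (suc N)) π + offset L            ∎
        where
        open ≤-Reasoning
        open +-*-Solver
        lP≤ : 2 ^ l * l ≤ weightOn l N E.mid p₀
        lP≤ = ≤-trans (≤-reflexive (*-comm (2 ^ l) l)) (m+n≤o⇒n≤o _ (Search.Found.sumA F))
        both : 2 ^ L ≤ (m₂ + 1) + (m₃ + 1)
        both = ≤-trans (≤-reflexive (cong (2 ^ l +_) (+-identityʳ (2 ^ l))))
                 (+-mono-≤ (large-pays l m₂ lP≤ hA′) (large-pays l m₃ lP≤ (hA l)))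

largeOn-none : ∀ l m (c : Conf k) p → m ≤ tri l → largeOn l m c p ≡ 0
largeOn-none l zero    c p _  = refl
largeOn-none l (suc m) c p le rewrite largeOn-none l m c p (<⇒≤ le) | ind-no (tri l ≤? m) (<⇒≱ le) = *-zeroʳ (ind (c m ≟ᶠ p))

lower-bound-suc : ∀ N → (∀ {m} → m < suc N → LowerBound m) → LowerBound (suc N)
lower-bound-suc N lower-bound l {p} {q} p≢q {u} {v} π free with u N ≟ᶠ p
lower-bound-suc N lower-bound l {p} {q} p≢q {u} {v} π free | no ne = begin
  weightOn l N u p + 0                 ≡⟨ +-identityʳ _ ⟩
  weightOn l N u p                     ≤⟨ lower-bound ≤-refl l p≢q π (λ i<N → free (m<n⇒m<1+n i<N)) ⟩
  cost (below N) π + offset l       ≤⟨ +-monoˡ-≤ (offset l) (below-suc-≤ N π) ⟩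
  cost (below (suc N)) π + offset l ∎
  where open ≤-Reasoning
lower-bound-suc N lower-bound l {p} {q} p≢q {u} {v} π free | yes e = go l
  where
  open ≤-Reasoning
  module M = FirstMove (first-move N π (λ eq → proj₁ (free ≤-refl) (trans (sym eq) e)))
  at : ∀ l → weightOn l (suc N) u p ≡ weightOn l N u p + 1 * weight l N
  at l = cong (λ a → weightOn l N u p + a * weight l N) (ind-yes (u N ≟ᶠ p) e)
  go : ∀ l → weightOn l N u p + 1 * weight l N ≤ cost (below (suc N)) π + offset l
  go zero = begin
    weightOn 0 N u p + 1               ≤⟨ +-monoˡ-≤ 1 (lower-bound ≤-refl 0 p≢q π (λ i<N → free (m<n⇒m<1+n i<N))) ⟩
    cost (below N) π + 0 + 1    ≡⟨ cong (_+ 1) (+-identityʳ _) ⟩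
    cost (below N) π + 1        ≤⟨ below-suc-moved N π (λ f → ≤-trans (M.after≥ f)
                                     (≤-trans (m≤n+m _ _) (≤-reflexive (sym (M.cost≡ f))))) ⟩
    cost (below (suc N)) π      ≡⟨ +-identityʳ _ ⟨
    cost (below (suc N)) π + 0  ∎
  go (suc l) with largeOn (suc l) (suc N) u p ≤? suc l
  -- Raising the level adds 2 ^ l for each of at most `suc l` disks, which the growth of `offset`
  -- absorbs.
  ... | yes few = begin
    weightOn (suc l) N u p + 1 * weight (suc l) N                     ≡⟨ at (suc l) ⟨
    weightOn (suc l) (suc N) u p                                 ≡⟨ weightOn-suc l (suc N) u p ⟩
    weightOn l (suc N) u p + 2 ^ l * largeOn (suc l) (suc N) u p       ≤⟨ +-mono-≤ (≤-trans (≤-reflexive (at l)) (go l)) (*-monoʳ-≤ (2 ^ l) few) ⟩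
    cost (below (suc N)) π + offset l + 2 ^ l * suc l         ≡⟨ +-assoc (cost (below (suc N)) π) (offset l) (2 ^ l * suc l) ⟩
    cost (below (suc N)) π + offset (suc l)                   ∎
  -- As some disk is large, so is `N`, with weight 2 ^ suc l; at least `suc l` large disks remain
  -- below it.
  ... | no many = begin
    weightOn (suc l) N u p + 1 * weight (suc l) N   ≡⟨ cong (weightOn (suc l) N u p +_) (trans (*-identityˡ _) (weight-large (suc l) t≤N)) ⟩
    weightOn (suc l) N u p + 2 ^ suc l         ≤⟨ InductionStep.bound N lower-bound l p≢q π free r≤ e ⟩
    cost (below (suc N)) π + offset (suc l) ∎
    where
    t≤N : tri (suc l) ≤ N
    t≤N = ≮⇒≥ λ N<t → many (subst (_≤ suc l) (sym (largeOn-none (suc l) (suc N) u p N<t)) z≤n)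
    r≤ : suc l ≤ largeOn (suc l) N u p
    r≤ = s≤s⁻¹ (≤-trans (≰⇒> many) (≤-trans
      (+-monoʳ-≤ (largeOn (suc l) N u p) (*-mono-≤ (ind≤1 (u N ≟ᶠ p)) (ind≤1 (tri (suc l) ≤? N))))
      (≤-reflexive (+-comm _ 1))))

lower-bound : ∀ m → LowerBound m
lower-bound = <-rec LowerBound by-size
  where
  by-size : ∀ m → (∀ {i} → i < m → LowerBound i) → LowerBound m
  by-size zero    rec l p≢q π free = z≤n
  by-size (suc N) rec = lower-bound-suc N rec

-- The lower bound for whole towers.

length : ∀ {n} {u v : Conf k} → Path n u v → ℕ
length = cost (λ _ → 1)

weightOn-full : ∀ l N {c : Conf 4} {p} → (∀ {i} → i < N → c i ≡ p) → weightOn l N c p ≡ totalWeight l N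
weightOn-full l N {c} {p} on = Σ<-cong N (λ {i} i<N → trans (cong (_* weight l i) (ind-yes (c i ≟ᶠ p) (on i<N))) (*-identityˡ _))

tower-bound : ∀ N l {n} {u v : Conf 4} {p q} → p ≢ q → (π : Path n u v) →
              (∀ {i} → i < suc N → u i ≡ p) → (∀ {i} → i < suc N → v i ≡ q) →
              2 * totalWeight l N + 1 ≤ length π + 2 * offset l
tower-bound N l {n} {u} {v} {p} {q} p≢q π on-p on-q = begin
  2 * totalWeight l N + 1
    ≡⟨ solve 1 (λ x → con 2 :* x :+ con 1 := x :+ x :+ con 1) refl (totalWeight l N) ⟩
  totalWeight l N + totalWeight l N + 1
    ≡⟨ cong₂ (λ x y → x + y + 1) (weightOn-full l N (λ i<N → trans (on-p (m<n⇒m<1+n i<N)) (sym (on-p ≤-refl))))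
                                 (weightOn-full l N (λ i<N → trans (on-q (m<n⇒m<1+n i<N)) (sym (on-q ≤-refl)))) ⟨
  weightOn l N u (u N) + weightOn l N v (v N) + 1
    ≤⟨ +-monoˡ-≤ 1 (+-mono-≤ (lower-bound N l (≢-sym P.a≢) P.α P.free-t) (lower-bound N l (≢-sym P.b≢) P.γ P.free-y)) ⟩
  (cost (below N) P.α + offset l) + (cost (below N) P.γ + offset l) + 1
    ≤⟨ +-mono-≤ (+-mono-≤ (+-monoˡ-≤ (offset l) (cost-mono below≤1 P.α)) (+-monoˡ-≤ (offset l) (cost-mono below≤1 P.γ))) (P.μ≥ (λ _ → 1)) ⟩
  (length P.α + offset l) + (length P.γ + offset l) + length P.μ
    ≡⟨ solve 4 (λ a g m c → (a :+ c) :+ (g :+ c) :+ m := (a :+ (m :+ g)) :+ con 2 :* c) refl (length P.α) (length P.γ) (length P.μ) (offset l) ⟩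
  length P.α + (length P.μ + length P.γ) + 2 * offset l
    ≡⟨ cong (_+ 2 * offset l) (P.cost≡ (λ _ → 1)) ⟨
  length π + 2 * offset l ∎
  where
  open ≤-Reasoning
  open +-*-Solver
  module P = FirstAndLastMove (first-and-last-move N π (λ eq → p≢q (trans (sym (on-p ≤-refl)) (trans eq (on-q ≤-refl)))))
  below≤1 : ∀ d → below N d ≤ 1
  below≤1 d = ind≤1 (d <? N)

-- Configurations as states

-- Larger disks are appended at the end, since stacks are listed from the top.
stack : ℕ → Conf k → Fin k → Stack
stack zero    c i = []
stack (suc n) c i with c n ≟ᶠ i
... | yes _ = stack n c i ∷ʳ n
... | no _  = stack n c i

stack-yes : ∀ n (c : Conf k) {i} → c n ≡ i → stack (suc n) c i ≡ stack n c i ∷ʳ n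
stack-yes n c {i} e with c n ≟ᶠ i
... | yes _ = refl
... | no ne = contradiction e ne

stack-no : ∀ n (c : Conf k) {i} → c n ≢ i → stack (suc n) c i ≡ stack n c i
stack-no n c {i} ne with c n ≟ᶠ i
... | yes e = contradiction e ne
... | no _  = refl

stack-cong : ∀ n {c c′ : Conf k} {i} → (∀ {e} → e < n → c e ≡ i → c′ e ≡ i) →
             (∀ {e} → e < n → c′ e ≡ i → c e ≡ i) → stack n c i ≡ stack n c′ i
stack-cong zero    f g = refl
stack-cong (suc n) {c} {c′} {i} f g with c n ≟ᶠ i
... | yes e = trans (cong (_∷ʳ n) (stack-cong n (λ h → f (m<n⇒m<1+n h)) (λ h → g (m<n⇒m<1+n h))))
                    (sym (stack-yes n c′ (f ≤-refl e)))
... | no ne = trans (stack-cong n (λ h → f (m<n⇒m<1+n h)) (λ h → g (m<n⇒m<1+n h)))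
                    (sym (stack-no n c′ (λ e → ne (g ≤-refl e))))

stack-empty : ∀ n {c : Conf k} {i} → (∀ {e} → e < n → c e ≢ i) → stack n c i ≡ []
stack-empty zero    ne = refl
stack-empty (suc n) {c} ne = trans (stack-no n c (ne ≤-refl)) (stack-empty n (λ h → ne (m<n⇒m<1+n h)))

stack-full : ∀ n {c : Conf k} {i} → (∀ {e} → e < n → c e ≡ i) → stack n c i ≡ upTo n
stack-full zero    on = refl
stack-full (suc n) {c} on = trans (stack-yes n c (on ≤-refl))
  (trans (cong (_∷ʳ n) (stack-full n (λ h → on (m<n⇒m<1+n h)))) (List.upTo-∷ʳ n))

-- Stated for every `m` above the moved disk, so that the induction can start at this disk, over
-- which nothing lies.
stack-top : ∀ n {c c′ : Conf k} (s : Step n c c′) →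
            ∀ m → disk s < m → stack m c (c (disk s)) ≡ disk s ∷ stack m c′ (c (disk s))
stack-top n {c} {c′} s (suc m) d<m with m ≟ disk s
... | yes refl = trans (stack-yes m c refl) (trans (cong (_∷ʳ m) (stack-empty m (λ h → proj₁ (clear s h))))
    (cong (m ∷_) (sym (trans (stack-no m c′ (≢-sym (moves s)))
      (stack-empty m (λ h → λ e → proj₁ (clear s h) (trans (sym (rest s (<⇒≢ h))) e)))))))
... | no ne with c m ≟ᶠ c (disk s)
...   | yes e  = trans (cong (_∷ʳ m) (stack-top n s m (≤∧≢⇒< (s≤s⁻¹ d<m) (≢-sym ne))))
                   (cong (disk s ∷_) (sym (stack-yes m c′ (trans (rest s ne) e))))
...   | no ne′ = trans (stack-top n s m (≤∧≢⇒< (s≤s⁻¹ d<m) (≢-sym ne)))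
                   (cong (disk s ∷_) (sym (stack-no m c′ (λ e → ne′ (trans (sym (rest s ne)) e)))))

stack-nil : ∀ n (c : Conf k) {i} → stack n c i ≡ [] → ∀ {e} → e < n → c e ≢ i
stack-nil (suc n) c {i} eq {e} e<n with c n ≟ᶠ i
... | yes _ = contradiction (List.++-conicalʳ (stack n c i) _ eq) λ ()
... | no ne with e ≟ n
...   | yes refl = ne
...   | no e≢n   = stack-nil n c eq (≤∧≢⇒< (s≤s⁻¹ e<n) e≢n)

stack-head : ∀ n (c : Conf k) {i d ds} → stack n c i ≡ d ∷ ds →
             d < n × c d ≡ i × (∀ {e} → e < d → c e ≢ i)
stack-head (suc n) c {i} eq with c n ≟ᶠ i
... | no _ = let a , b , f = stack-head n c eq in m<n⇒m<1+n a , b , f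
... | yes e with stack n c i in eq′
...   | [] with refl ← eq = ≤-refl , e , stack-nil n c eq′
...   | d ∷ ds with refl ← eq = let a , b , f = stack-head n c eq′ in m<n⇒m<1+n a , b , f

stack-fits : ∀ n (c : Conf k) {d j} → c d ≢ j → (∀ {e} → e < d → c e ≢ j) → Fits d (stack n c j)
stack-fits n c {d} {j} ne free with stack n c j in eq
... | []     = empty
... | e ∷ es = let _ , b , _ = stack-head n c eq in
               larger (≰⇒> λ e≤d → case (m≤n⇒m<n∨m≡n e≤d) b)
  where
  case : ∀ {e} → e < d ⊎ e ≡ d → c e ≡ j → ⊥
  case (inj₁ lt)   = free lt
  case (inj₂ refl) = ne

fits-free : ∀ n (c : Conf k) {d j} → d < n → Fits d (stack n c j) → ∀ {e} → e ≤ d → c e ≢ j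
fits-free n c {d} {j} d<n fit with stack n c j in eq
fits-free n c {d} {j} d<n empty        | []      = λ e≤d → stack-nil n c eq (≤-<-trans e≤d d<n)
fits-free n c {d} {j} d<n (larger d<e) | e ∷ es = λ e≤d → proj₂ (proj₂ (stack-head n c eq)) (≤-<-trans e≤d d<e)

toState : ℕ → Conf k → State k
toState n c = tabulate (stack n c)

lookup-toState : ∀ n (c : Conf k) i → lookup (toState n c) i ≡ stack n c i
lookup-toState n c = lookup∘tabulate (stack n c)

State-ext : {s s′ : State k} → lookup s ≗ lookup s′ → s ≡ s′
State-ext {s = s} {s′} eq = trans (sym (tabulate∘lookup s)) (trans (tabulate-cong eq) (tabulate∘lookup s′))

toState-tower : ∀ n {c : Conf k} {p} → (∀ {e} → e < n → c e ≡ p) → toState n c ≡ tower n p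
toState-tower n {c} {p} on = State-ext λ i → trans (lookup-toState n c i) (at i)
  where
  at : ∀ i → stack n c i ≡ lookup (tower n p) i
  at i with i ≟ᶠ p
  ... | yes refl = trans (stack-full n on) (sym (lookup∘update i (replicate _ []) (upTo n)))
  ... | no ne    = trans (stack-empty n (λ h e → ne (trans (sym e) (on h))))
                     (sym (trans (lookup∘update′ ne (replicate _ []) (upTo n)) (lookup-replicate i [])))

toState-step : ∀ {n} {c c′ : Conf k} (s : Step n c c′) → let i = c (disk s) ; j = c′ (disk s) in
               (toState n c [ i ]≔ stack n c′ i) [ j ]≔ (disk s ∷ lookup (toState n c) j) ≡ toState n c′
toState-step {n = n} {c} {c′} s = State-ext λ x → trans (at x) (sym (lookup-toState n c′ x))
  where
  i = c (disk s)
  j = c′ (disk s)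
  σ = toState n c [ i ]≔ stack n c′ i
  at : ∀ x → lookup (σ [ j ]≔ (disk s ∷ lookup (toState n c) j)) x ≡ stack n c′ x
  at x with x ≟ᶠ j
  ... | yes refl = trans (lookup∘update j σ _)
      (trans (cong (disk s ∷_) (lookup-toState n c j)) (sym (stack-top n (flip-step s) n (disk<n s))))
  ... | no x≢j with x ≟ᶠ i
  ...   | yes refl = trans (lookup∘update′ x≢j σ _) (lookup∘update i (toState n c) _)
  ...   | no x≢i   = trans (lookup∘update′ x≢j σ _) (trans (lookup∘update′ x≢i (toState n c) _)
      (trans (lookup-toState n c x) (stack-cong n
        (λ {e} _ eq → trans (rest s (λ { refl → x≢i (sym eq) })) eq)
        (λ {e} _ eq → trans (sym (rest s (λ { refl → x≢j (sym eq) }))) eq))))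

move-step : ∀ {n} {c c′ : Conf k} → Step n c c′ → toState n c ⟶ toState n c′
move-step {n = n} {c} {c′} s = subst (toState n c ⟶_) (toState-step s)
  (move (moves s) (trans (lookup-toState n c _) (stack-top n s n (disk<n s)))
    (subst (Fits (disk s)) (sym (lookup-toState n c _)) (stack-fits n c (moves s) (λ h → proj₂ (clear s h)))))

moves-path : ∀ {n} {c c′ : Conf k} (π : Path n c c′) → toState n c ⟶[ length π ] toState n c′
moves-path {n = n} (stay e) = subst (toState n _ ⟶[ 0 ]_)
  (State-ext λ i → trans (lookup-toState n _ i) (trans
    (stack-cong n (λ _ eq → trans (sym (e _)) eq) (λ _ eq → trans (e _) eq)) (sym (lookup-toState n _ i)))) done
moves-path (s then π) = step (move-step s) (moves-path π)

put : ℕ → Fin k → Conf k → Conf k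
put d j c e with e ≟ d
... | yes _ = j
... | no _  = c e

put-same : ∀ d j (c : Conf k) → put d j c d ≡ j
put-same d j c with d ≟ d
... | yes _ = refl
... | no ne = contradiction refl ne

put-other : ∀ d j (c : Conf k) {e} → e ≢ d → put d j c e ≡ c e
put-other d j c {e} ne with e ≟ d
... | yes eq = contradiction eq ne
... | no _   = refl

-- The converse of `move-step`: `stack-head` shows that nothing smaller is on the peg left, and
-- `fits-free` the same for the peg reached.
step-move : ∀ {n} (c : Conf k) {s′} → toState n c ⟶ s′ → ∃ λ c′ → Step n c c′ × s′ ≡ toState n c′
step-move {n = n} c (move {i} {j} {d} {ds} i≢j eq fit)
  with stack-head n c (trans (sym (lookup-toState n c i)) eq)
... | d<n , refl , top = put d j c , s , trans (cong (λ x → (toState n c [ c d ]≔ x) [ j ]≔ _) ds≡)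
                            (subst (λ j′ → (toState n c [ c d ]≔ stack n (put d j c) (c d)) [ j′ ]≔ (d ∷ lookup (toState n c) j′) ≡ toState n (put d j c))
                               (put-same d j c) (toState-step s))
  where
  free : ∀ {e} → e ≤ d → c e ≢ j
  free = fits-free n c d<n (subst (Fits d) (lookup-toState n c j) fit)
  s : Step n c (put d j c)
  s = record
    { disk = d ; disk<n = d<n
    ; moves = λ e → i≢j (trans e (put-same d j c))
    ; clear = λ h → top h , λ e → free (<⇒≤ h) (trans e (put-same d j c))
    ; rest = put-other d j c }
  ds≡ : ds ≡ stack n (put d j c) (c d)
  ds≡ = List.∷-injectiveʳ (trans (sym eq) (trans (lookup-toState n c (c d)) (stack-top n s n d<n)))

path-moves : ∀ {n t} (c : Conf k) {s s′} → s ≡ toState n c → s ⟶[ t ] s′ →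
             ∃ λ c′ → ∃ λ (π : Path n c c′) → length π ≡ t × s′ ≡ toState n c′
path-moves c eq done = c , stay (λ _ → refl) , refl , eq
path-moves c refl (step m ms) with step-move c m
... | c₁ , s , eq₁ with path-moves c₁ eq₁ ms
...   | c₂ , π , len , eq₂ = c₂ , s then π , cong suc len , eq₂

tower-toState : ∀ n {c : Conf k} {p} → tower n p ≡ toState n c → ∀ {e} → e < n → c e ≡ p
tower-toState n {c} {p} eq {e} e<n with c e ≟ᶠ p
... | yes at = at
... | no ne  = contradiction refl (stack-nil n c (trans (sym (lookup-toState n c (c e)))
    (trans (cong (λ s → lookup s (c e)) (sym eq))
      (trans (lookup∘update′ ne (replicate _ []) (upTo n)) (lookup-replicate (c e) [])))) e<n)

Transfer : ∀ k (n : ℕ) (p q : Fin k) → ℕ → Set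
Transfer k n p q t = ∃ λ u → ∃ λ v → ∃ λ (π : Path n u v) →
  length π ≡ t × (∀ {e} → e < n → u e ≡ p) × (∀ {e} → e < n → v e ≡ q)

transfer⁻ : ∀ {k n t} (P : Pegs k) → SolvableIn n k P t → Transfer k n (Pegs.source P) (Pegs.goal P) t
transfer⁻ {n = n} P sol with path-moves (λ _ → Pegs.source P) (sym (toState-tower n (λ _ → refl))) sol
... | v , π , len , eq = _ , v , π , len , (λ _ → refl) , tower-toState n eq

transfer⁺ : ∀ {k n t} (P : Pegs k) → Transfer k n (Pegs.source P) (Pegs.goal P) t → SolvableIn n k P t
transfer⁺ {n = n} P (u , v , π , refl , on , on′) =
  subst₂ (_⟶[ length π ]_) (toState-tower n on) (toState-tower n on′) (moves-path π)

-- The upper bound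

-- Disks l, ..., l + m - 1 imitate a play of `m` disks on the pegs in the image of `f`, while the
-- smaller ones wait on `x` and the larger ones stay as in `c`. The guard `e < l` lets `x` be any
-- peg when nothing waits there.
module Shift {k k′ : ℕ} (l : ℕ) (x : Fin k′) (f : Fin k → Fin k′)
             (inj : ∀ {i j} → f i ≡ f j → i ≡ j) (x∉f : ∀ {e} → e < l → ∀ i → f i ≢ x)
             (m : ℕ) (c : Conf k′) where

  shift : Conf k → Conf k′
  shift u e with e <? l
  ... | yes _ = x
  ... | no _ with e <? l + m
  ...   | yes _ = f (u (e ∸ l))
  ...   | no _  = c e

  shift-low : ∀ u {e} → e < l → shift u e ≡ x
  shift-low u {e} e<l with e <? l
  ... | yes _  = refl
  ... | no e≮l = contradiction e<l e≮l

  shift-mid : ∀ u {e} → e < m → shift u (l + e) ≡ f (u e)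
  shift-mid u {e} e<m with l + e <? l
  ... | yes h = contradiction h (≤⇒≯ (m≤m+n l e))
  ... | no _ with l + e <? l + m
  ...   | yes _ = cong (λ d → f (u d)) (m+n∸m≡n l e)
  ...   | no h  = contradiction (+-monoʳ-< l e<m) h

  shift-high : ∀ u {e} → l + m ≤ e → shift u e ≡ c e
  shift-high u {e} le with e <? l
  ... | yes h = contradiction h (≤⇒≯ (≤-trans (m≤m+n l m) le))
  ... | no _ with e <? l + m
  ...   | yes h = contradiction h (≤⇒≯ le)
  ...   | no _  = refl

  data View : ℕ → Set where
    low  : ∀ {e} → e < l → View e
    mid  : ∀ {d} → d < m → View (l + d)
    high : ∀ {e} → l + m ≤ e → View e

  view : ∀ e → View e
  view e with e <? l
  ... | yes e<l = low e<l
  ... | no e≮l with m≤n⇒∃[o]m+o≡n (≮⇒≥ e≮l)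
  ...   | d , refl with d <? m
  ...     | yes d<m = mid d<m
  ...     | no d≮m  = high (+-monoʳ-≤ l (≮⇒≥ d≮m))

  shift-cong : ∀ {u v} → u ≗ v → shift u ≗ shift v
  shift-cong {u} {v} eq e with view e
  ... | low h  = trans (shift-low u h) (sym (shift-low v h))
  ... | mid {d} h  = trans (shift-mid u h) (trans (cong f (eq d)) (sym (shift-mid v h)))
  ... | high h = trans (shift-high u h) (sym (shift-high v h))

  module _ {N : ℕ} (l+m≤N : l + m ≤ N) where

    shift-step : ∀ {u v} → Step m u v → Step N (shift u) (shift v)
    shift-step {u} {v} s = record
      { disk = l + disk s
      ; disk<n = <-≤-trans (+-monoʳ-< l (disk<n s)) l+m≤N
      ; moves = λ eq → moves s (inj (trans (sym at-u) (trans eq at-v)))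
      ; clear = λ h → clear′ (view _) h
      ; rest = λ ne → rest′ (view _) ne
      }
      where
      at-u = shift-mid u (disk<n s)
      at-v = shift-mid v (disk<n s)
      clear′ : ∀ {e} → View e → e < l + disk s →
               shift u e ≢ shift u (l + disk s) × shift u e ≢ shift v (l + disk s)
      clear′ (low h) _ =
          (λ eq → x∉f h _ (trans (sym at-u) (trans (sym eq) (shift-low u h))))
        , (λ eq → x∉f h _ (trans (sym at-v) (trans (sym eq) (shift-low u h))))
      clear′ (mid {d} h) lt =
        let a , b = clear s (+-cancelˡ-< l d (disk s) lt) in
          (λ eq → a (inj (trans (sym (shift-mid u h)) (trans eq at-u))))
        , (λ eq → b (inj (trans (sym (shift-mid u h)) (trans eq at-v))))
      clear′ (high h) lt = contradiction (≤-trans (+-monoʳ-≤ l (<⇒≤ (disk<n s))) h) (<⇒≱ lt)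
      rest′ : ∀ {e} → View e → e ≢ l + disk s → shift v e ≡ shift u e
      rest′ (low h)  _  = trans (shift-low v h) (sym (shift-low u h))
      rest′ (mid h)  ne = trans (shift-mid v h)
        (trans (cong f (rest s (λ { refl → ne refl }))) (sym (shift-mid u h)))
      rest′ (high h) _  = trans (shift-high v h) (sym (shift-high u h))

    shift-path : ∀ {u v} → Path m u v → Path N (shift u) (shift v)
    shift-path (stay e)   = stay (shift-cong e)
    shift-path (s then π) = shift-step s then shift-path π

    length-shift : ∀ {u v} (π : Path m u v) → length (shift-path π) ≡ length π
    length-shift (stay e)   = refl
    length-shift (s then π) = cong suc (length-shift π)

_↝[_,_]_ : ∀ {k} → Conf k → ℕ → ℕ → Conf k → Set
u ↝[ n , t ] v = ∃ λ (π : Path n u v) → length π ≡ t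

_▸_ : ∀ {n t t′} {u v z : Conf k} → u ↝[ n , t ] v → v ↝[ n , t′ ] z → u ↝[ n , t + t′ ] z
(π , refl) ▸ (ρ , refl) = π ▷ ρ , cost-▷ (λ _ → 1) π ρ

reshape : ∀ {n t} {u u′ v v′ : Conf k} → u′ ≗ u → v ≗ v′ → u ↝[ n , t ] v → u′ ↝[ n , t ] v′
reshape eu ev (π , refl) = path-from eu (π ▷ stay ev) ,
  trans (cost-from eu (π ▷ stay ev)) (trans (cost-▷ (λ _ → 1) π (stay ev)) (+-identityʳ _))

-- The states between the phases of the Frame-Stewart strategy: a small tower, a middle tower and
-- the disks above, in particular the largest one.
three : ℕ → ℕ → (a b : Fin k) → Conf k → Conf k
three l m a b c e with e <? l
... | yes _ = a
... | no _ with e <? l + m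
...   | yes _ = b
...   | no _  = c e

module _ (l m : ℕ) where

  three-low : ∀ (a b : Fin k) c {e} → e < l → three l m a b c e ≡ a
  three-low a b c {e} h with e <? l
  ... | yes _ = refl
  ... | no ¬h = contradiction h ¬h

  three-mid : ∀ (a b : Fin k) c {e} → l ≤ e → e < l + m → three l m a b c e ≡ b
  three-mid a b c {e} le h with e <? l
  ... | yes h′ = contradiction le (<⇒≱ h′)
  ... | no _ with e <? l + m
  ...   | yes _ = refl
  ...   | no ¬h = contradiction h ¬h

  three-high : ∀ (a b : Fin k) c {e} → l + m ≤ e → three l m a b c e ≡ c e
  three-high a b c {e} le with e <? l
  ... | yes h = contradiction (≤-trans (m≤m+n l m) le) (<⇒≱ h)
  ... | no _ with e <? l + m
  ...   | yes h = contradiction le (<⇒≱ h)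
  ...   | no _  = refl

  three-all : ∀ (a : Fin k) c {e} → e < suc (l + m) → c (l + m) ≡ a → three l m a a c e ≡ a
  three-all a c {e} h eq with e <? l
  ... | yes _ = refl
  ... | no _ with e <? l + m
  ...   | yes _ = refl
  ...   | no ¬h = trans (cong c (≤-antisym (s≤s⁻¹ h) (≮⇒≥ ¬h))) eq

  move-small : ∀ {t} {p q : Fin k} (f : Fin k → Fin k) → (∀ {i j} → f i ≡ f j → i ≡ j) →
               Transfer k l p q t → ∀ b c →
               three l m (f p) b c ↝[ suc (l + m) , t ] three l m (f q) b c
  move-small {k = k} f inj (u , v , π , len , on-p , on-q) b c =
    reshape (λ e → sym (same on-p e)) (same on-q)
      (Sh.shift-path (m≤n⇒m≤1+n (m≤m+n l m)) π , trans (Sh.length-shift _ π) len)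
    where
    -- No disk waits here, so the waiting peg is arbitrary, and `b` fills its place.
    module Sh = Shift 0 b f inj (λ ()) l (three l m b b c)
    same : ∀ {u p} → (∀ {e} → e < l → u e ≡ p) → ∀ e → Sh.shift u e ≡ three l m (f p) b c e
    same {u} {p} on e with Sh.view e
    ... | Sh.mid h  = trans (Sh.shift-mid u h) (trans (cong f (on h)) (sym (three-low (f p) b c h)))
    ... | Sh.high h with e <? l + m
    ...   | yes h′ = trans (Sh.shift-high u h) (trans (three-mid b b c h h′) (sym (three-mid (f p) b c h h′)))
    ...   | no h′  = trans (Sh.shift-high u h)
                       (trans (three-high b b c (≮⇒≥ h′)) (sym (three-high (f p) b c (≮⇒≥ h′))))

  move-middle : ∀ {t} {p q : Fin 3} (f : Fin 3 → Fin k) → (∀ {i j} → f i ≡ f j → i ≡ j) → ∀ x →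
                (∀ {e} → e < l → ∀ i → f i ≢ x) → Transfer 3 m p q t → ∀ c →
                three l m x (f p) c ↝[ suc (l + m) , t ] three l m x (f q) c
  move-middle {k = k} f inj x x∉f (u , v , π , len , on-p , on-q) c =
    reshape (λ e → sym (same on-p e)) (same on-q)
      (Sh.shift-path (n≤1+n (l + m)) π , trans (Sh.length-shift _ π) len)
    where
    module Sh = Shift l x f inj x∉f m c
    same : ∀ {u p} → (∀ {e} → e < m → u e ≡ p) → ∀ e → Sh.shift u e ≡ three l m x (f p) c e
    same {u} {p} on e with Sh.view e
    ... | Sh.low h     = trans (Sh.shift-low u h) (sym (three-low x (f p) c h))
    ... | Sh.mid {d} h = trans (Sh.shift-mid u h)
                           (trans (cong f (on h)) (sym (three-mid x (f p) c (m≤m+n l d) (+-monoʳ-< l h))))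
    ... | Sh.high h    = trans (Sh.shift-high u h) (sym (three-high x (f p) c h))

  move-large : ∀ {p q x y : Fin k} → p ≢ q → x ≢ p → x ≢ q → y ≢ p → y ≢ q → ∀ c → c (l + m) ≡ p →
               three l m x y c ↝[ suc (l + m) , 1 ] three l m x y (put (l + m) q c)
  move-large {p = p} {q} {x} {y} p≢q x≢p x≢q y≢p y≢q c at-p = record
      { disk   = l + m
      ; disk<n = ≤-refl
      ; moves  = λ eq → p≢q (trans (sym at) (trans eq at′))
      ; clear  = λ {e} h → (λ eq → proj₁ (off e h) (trans eq at)) , (λ eq → proj₂ (off e h) (trans eq at′))
      ; rest   = unchanged
      } then stay (λ _ → refl) , refl
    where
    at : three l m x y c (l + m) ≡ p
    at = trans (three-high x y c ≤-refl) at-p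
    at′ : three l m x y (put (l + m) q c) (l + m) ≡ q
    at′ = trans (three-high x y (put (l + m) q c) ≤-refl) (put-same (l + m) q c)
    off : ∀ e → e < l + m → three l m x y c e ≢ p × three l m x y c e ≢ q
    off e h with e <? l
    ... | yes _ = x≢p , x≢q
    ... | no _ with e <? l + m
    ...   | yes _ = y≢p , y≢q
    ...   | no ¬h = contradiction h ¬h
    unchanged : ∀ {e} → e ≢ l + m → three l m x y (put (l + m) q c) e ≡ three l m x y c e
    unchanged {e} ne with e <? l
    ... | yes _ = refl
    ... | no _ with e <? l + m
    ...   | yes _ = refl
    ...   | no _  = put-other (l + m) q c ne

-- Relabelling and embedding pegs.

transpose-injective : ∀ {n} (a b : Fin n) {i j} → transpose a b i ≡ transpose a b j → i ≡ j
transpose-injective a b eq =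
  trans (sym (transpose-inverse b a)) (trans (cong (transpose b a) eq) (transpose-inverse b a))

transpose-left : ∀ {n} (a b : Fin n) → transpose a b a ≡ b
transpose-left a b with a ≟ᶠ a
... | yes _ = refl
... | no ne = contradiction refl ne

transpose-fixed : ∀ {n} (a b : Fin n) {i} → i ≢ a → i ≢ b → transpose a b i ≡ i
transpose-fixed a b {i} i≢a i≢b with i ≟ᶠ a
... | yes e = contradiction e i≢a
... | no _ with i ≟ᶠ b
...   | yes e = contradiction e i≢b
...   | no _  = refl

-- The first transposition sends `a` to `p`; the second sends the image of `b` to `q` and fixes `p`.
relabel : {a b p q : Fin k} → a ≢ b → p ≢ q →
          ∃ λ (f : Fin k → Fin k) → (∀ {i j} → f i ≡ f j → i ≡ j) × f a ≡ p × f b ≡ q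
relabel {a = a} {b} {p} {q} a≢b p≢q =
    (λ i → transpose b′ q (transpose a p i))
  , (λ eq → transpose-injective a p (transpose-injective b′ q eq))
  , trans (cong (transpose b′ q) (transpose-left a p))
          (transpose-fixed b′ q (λ eq → a≢b (transpose-injective a p (trans (transpose-left a p) eq))) p≢q)
  , transpose-left b′ q
  where
  b′ = transpose a p b

third-of-three : (a b i j : Fin 3) → a ≢ b → i ≢ a → i ≢ b → j ≢ a → j ≢ b → i ≡ j
third-of-three = toWitness {a? = all? λ a → all? λ b → all? λ i → all? λ j →
  ¬? (a ≟ᶠ b) →-dec ¬? (i ≟ᶠ a) →-dec ¬? (i ≟ᶠ b) →-dec ¬? (j ≟ᶠ a) →-dec ¬? (j ≟ᶠ b) →-dec (i ≟ᶠ j)} tt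

embed : {a b : Fin 3} {p q y : Fin k} → a ≢ b → p ≢ q → y ≢ p → y ≢ q →
        ∃ λ (f : Fin 3 → Fin k) → (∀ {i j} → f i ≡ f j → i ≡ j) × f a ≡ p × f b ≡ q ×
                                  (∀ i → f i ≡ p ⊎ f i ≡ q ⊎ f i ≡ y)
embed {k = k} {a} {b} {p} {q} {y} a≢b p≢q y≢p y≢q = f , inj , f-a , f-b , range
  where
  f : Fin 3 → Fin k
  f i with i ≟ᶠ a | i ≟ᶠ b
  ... | yes _ | _     = p
  ... | no _  | yes _ = q
  ... | no _  | no _  = y
  f-a : f a ≡ p
  f-a with a ≟ᶠ a | a ≟ᶠ b
  ... | yes _ | _ = refl
  ... | no ne | _ = contradiction refl ne
  f-b : f b ≡ q
  f-b with b ≟ᶠ a | b ≟ᶠ b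
  ... | yes e | _     = contradiction (sym e) a≢b
  ... | no _  | yes _ = refl
  ... | no _  | no ne = contradiction refl ne
  range : ∀ i → f i ≡ p ⊎ f i ≡ q ⊎ f i ≡ y
  range i with i ≟ᶠ a | i ≟ᶠ b
  ... | yes _ | _     = inj₁ refl
  ... | no _  | yes _ = inj₂ (inj₁ refl)
  ... | no _  | no _  = inj₂ (inj₂ refl)
  inj : ∀ {i j} → f i ≡ f j → i ≡ j
  inj {i} {j} eq with i ≟ᶠ a | i ≟ᶠ b | j ≟ᶠ a | j ≟ᶠ b
  ... | yes e | _     | yes e′ | _      = trans e (sym e′)
  ... | yes _ | _     | no _   | yes _  = contradiction eq p≢q
  ... | yes _ | _     | no _   | no _   = contradiction (sym eq) y≢p
  ... | no _  | yes _ | yes _  | _      = contradiction (sym eq) p≢q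
  ... | no _  | yes e | no _   | yes e′ = trans e (sym e′)
  ... | no _  | yes _ | no _   | no _   = contradiction (sym eq) y≢q
  ... | no _  | no _  | yes _  | _      = contradiction eq y≢p
  ... | no _  | no _  | no _   | yes _  = contradiction eq y≢q
  ... | no ne | no ne₂ | no ne₃ | no ne₄ = third-of-three a b i j a≢b ne ne₂ ne₃ ne₄

-- The small tower goes to `x`, the middle one to `y` without using `x`, and both follow the largest
-- disk to the goal. As `x ≢ y` is demanded only for a nonempty small tower, the case l = 0 covers
-- the classical strategy on three pegs.
frame-stewart : ∀ {k l m t t′} (P : Pegs k) (P₃ : Pegs 3) (x y : Fin k) → let open Pegs P in
                x ≢ source → x ≢ goal → y ≢ source → y ≢ goal → (∀ {e} → e < l → x ≢ y) →
                SolvableIn l k P t → SolvableIn m 3 P₃ t′ →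
                SolvableIn (suc (l + m)) k P (2 * t + 2 * t′ + 1)
frame-stewart {k} {l} {m} {t} {t′} P P₃ x y x≢p x≢q y≢p y≢q x≢y sol sol₃ =
  transfer⁺ P (_ , _ , proj₁ route , trans (proj₂ route) count , start , end)
  where
  open Pegs P renaming (source to p; goal to q; source≢goal to p≢q)
  module Q = Pegs P₃
  c c′ : Conf k
  c _ = p
  c′ = put (l + m) q c
  small : ∀ {a a′} → a ≢ a′ → ∀ b c → three l m a b c ↝[ suc (l + m) , t ] three l m a′ b c
  small a≢a′ b c with relabel p≢q a≢a′
  ... | f , inj , refl , refl = move-small l m f inj (transfer⁻ P sol) b c
  middle : ∀ {b b′ b″} → b ≢ b′ → b″ ≢ b → b″ ≢ b′ → (∀ {e} → e < l → b ≢ x × b′ ≢ x × b″ ≢ x) →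
           ∀ c → three l m x b c ↝[ suc (l + m) , t′ ] three l m x b′ c
  middle b≢b′ b″≢b b″≢b′ off c with embed Q.source≢goal b≢b′ b″≢b b″≢b′
  ... | f , inj , refl , refl , range = move-middle l m f inj x (λ h i → avoid h (range i)) (transfer⁻ P₃ sol₃) c
    where
    avoid : ∀ {e i} → e < l → f i ≡ f Q.source ⊎ f i ≡ f Q.goal ⊎ f i ≡ _ → f i ≢ x
    avoid h (inj₁ eq)        eq′ = proj₁ (off h) (trans (sym eq) eq′)
    avoid h (inj₂ (inj₁ eq)) eq′ = proj₁ (proj₂ (off h)) (trans (sym eq) eq′)
    avoid h (inj₂ (inj₂ eq)) eq′ = proj₂ (proj₂ (off h)) (trans (sym eq) eq′)
  route : three l m p p c ↝[ suc (l + m) , t + (t′ + (1 + (t′ + t))) ] three l m q q c′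
  route = small (≢-sym x≢p) p c
        ▸ (middle (≢-sym y≢p) (≢-sym p≢q) (≢-sym y≢q) (λ h → ≢-sym x≢p , ≢-sym (x≢y h) , ≢-sym x≢q) c
        ▸ (move-large l m p≢q x≢p x≢q y≢p y≢q c refl
        ▸ (middle y≢q (≢-sym y≢p) p≢q (λ h → ≢-sym (x≢y h) , ≢-sym x≢q , ≢-sym x≢p) c′
        ▸ small x≢q q c′)))
  count : t + (t′ + (1 + (t′ + t))) ≡ 2 * t + 2 * t′ + 1
  count = solve 2 (λ t u → t :+ (u :+ (con 1 :+ (u :+ t))) := con 2 :* t :+ con 2 :* u :+ con 1) refl t t′
    where open +-*-Solver
  start : ∀ {e} → e < suc (l + m) → three l m p p c e ≡ p
  start h = three-all l m p c h refl
  end : ∀ {e} → e < suc (l + m) → three l m q q c′ e ≡ q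
  end h = three-all l m q c′ h (put-same (l + m) q c)

-- Bounds for `T` and the recursion.

T-≤ : ∀ {n k t} (P : Pegs k) → SolvableIn n k P t → T n k P ≤ t
T-≤ {n} {k} P = proj₂ (T-isLeast n k P)

T-0 : ∀ k (P : Pegs k) → T 0 k P ≡ 0
T-0 k P = n≤0⇒n≡0 (T-≤ {0} P (transfer⁺ {n = 0} P
  ((λ _ → Pegs.source P) , (λ _ → Pegs.source P) , stay (λ _ → refl) , refl , (λ ()) , (λ ()))))

spare : (p q : Fin 3) → ∃ λ r → r ≢ p × r ≢ q
spare = toWitness {a? = all? λ p → all? λ q → any? λ r → ¬? (r ≟ᶠ p) ×-dec ¬? (r ≟ᶠ q)} tt

-- The Frame-Stewart strategy with an empty small tower; the spare peg serves as both `x` and `y`.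
T₃-suc : ∀ m (P : Pegs 3) → T (suc m) 3 P ≤ 2 * T m 3 P + 1
T₃-suc m P with spare (Pegs.source P) (Pegs.goal P)
... | x , x≢p , x≢q = ≤-trans (T-≤ P (frame-stewart {l = 0} P P x x x≢p x≢q x≢p x≢q (λ ())
                                 (proj₁ (T-isLeast 0 3 P)) (proj₁ (T-isLeast m 3 P))))
                        (≤-reflexive (cong (λ t → 2 * t + 2 * T m 3 P + 1) (T-0 3 P)))

T₃-≤ : ∀ m (P : Pegs 3) → T m 3 P + 1 ≤ 2 ^ m
T₃-≤ zero    P = ≤-reflexive (cong (_+ 1) (T-0 3 P))
T₃-≤ (suc m) P = begin
  T (suc m) 3 P + 1     ≤⟨ +-monoˡ-≤ 1 (T₃-suc m P) ⟩
  2 * T m 3 P + 1 + 1   ≡⟨ solve 1 (λ t → con 2 :* t :+ con 1 :+ con 1 := con 2 :* (t :+ con 1)) refl (T m 3 P) ⟩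
  2 * (T m 3 P + 1)     ≤⟨ *-monoʳ-≤ 2 (T₃-≤ m P) ⟩
  2 ^ suc m             ∎
  where
  open ≤-Reasoning
  open +-*-Solver

module _ (P₃ : Pegs 3) (P₄ : Pegs 4) where
  open Pegs P₄

  T₄ T₃ : ℕ → ℕ
  T₄ n = T n 4 P₄
  T₃ n = T n 3 P₃

  T₄-≤ : ∀ l m → T₄ (suc (l + m)) ≤ 2 * T₄ l + 2 * T₃ m + 1
  T₄-≤ l m with another-peg source source goal
  ... | x , _ , x≢p , x≢q with another-peg source goal x
  ...   | y , y≢p , y≢q , y≢x =
    T-≤ P₄ (frame-stewart P₄ P₃ x y x≢p x≢q y≢p y≢q (λ _ → ≢-sym y≢x)
              (proj₁ (T-isLeast l 4 P₄)) (proj₁ (T-isLeast m 3 P₃)))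

  T₄-suc-≤ : ∀ l m t → T₄ l ≤ t → T₄ (suc (l + m)) + 1 ≤ 2 * t + 2 ^ suc m
  T₄-suc-≤ l m t h = begin
    T₄ (suc (l + m)) + 1           ≤⟨ +-monoˡ-≤ 1 (T₄-≤ l m) ⟩
    2 * T₄ l + 2 * T₃ m + 1 + 1    ≡⟨ solve 2 (λ a b → con 2 :* a :+ con 2 :* b :+ con 1 :+ con 1 := con 2 :* a :+ con 2 :* (b :+ con 1)) refl (T₄ l) (T₃ m) ⟩
    2 * T₄ l + 2 * (T₃ m + 1)      ≤⟨ +-mono-≤ (*-monoʳ-≤ 2 h) (*-monoʳ-≤ 2 (T₃-≤ m P₃)) ⟩
    2 * t + 2 ^ suc m              ∎
    where
    open ≤-Reasoning
    open +-*-Solver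

  -- The Frame-Stewart number for tri l + r disks is (l + r - 1) 2 ^ l + 1. `raise` takes a middle
  -- tower of `l` disks; `last` gets the overlap r = l + 1, which is also the case r = 0 of the next
  -- `l`, from r = 0.
  T₄-upper : ∀ l r → r ≤ suc l → T₄ (tri l + r) + 2 ^ l ≤ 2 ^ l * (l + r) + 1
  T₄-upper l r h = go l r (m≤n⇒m<n∨m≡n h)
    where
    open ≤-Reasoning
    open +-*-Solver
    t = λ l r → T₄ (tri l + r)
    raise : ∀ l r → t l r + 2 ^ l ≤ 2 ^ l * (l + r) + 1 → t (suc l) r + 2 ^ suc l ≤ 2 ^ suc l * (suc l + r) + 1
    raise l r h = +-cancelʳ-≤ 1 _ _ (begin
      t (suc l) r + 2 * 2 ^ l + 1
        ≡⟨ cong (λ n → T₄ n + 2 * 2 ^ l + 1) (solve 3 (λ l a r → con 1 :+ l :+ a :+ r := con 1 :+ (a :+ r :+ l)) refl l (tri l) r) ⟩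
      T₄ (suc (tri l + r + l)) + 2 * 2 ^ l + 1
        ≡⟨ solve 2 (λ a p → a :+ p :+ con 1 := a :+ con 1 :+ p) refl (T₄ (suc (tri l + r + l))) (2 * 2 ^ l) ⟩
      T₄ (suc (tri l + r + l)) + 1 + 2 * 2 ^ l
        ≤⟨ +-monoˡ-≤ (2 * 2 ^ l) (T₄-suc-≤ (tri l + r) l (t l r) ≤-refl) ⟩
      2 * t l r + 2 * 2 ^ l + 2 * 2 ^ l
        ≡⟨ solve 2 (λ t p → con 2 :* t :+ con 2 :* p :+ con 2 :* p := con 2 :* (t :+ p) :+ con 2 :* p) refl (t l r) (2 ^ l) ⟩
      2 * (t l r + 2 ^ l) + 2 * 2 ^ l
        ≤⟨ +-monoˡ-≤ (2 * 2 ^ l) (*-monoʳ-≤ 2 h) ⟩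
      2 * (2 ^ l * (l + r) + 1) + 2 * 2 ^ l
        ≡⟨ solve 3 (λ p l r → con 2 :* (p :* (l :+ r) :+ con 1) :+ con 2 :* p := con 2 :* p :* (con 1 :+ l :+ r) :+ con 1 :+ con 1) refl (2 ^ l) l r ⟩
      2 ^ suc l * (suc l + r) + 1 + 1 ∎)
    last : ∀ l → t l 0 + 2 ^ l ≤ 2 ^ l * (l + 0) + 1 → t l (suc l) + 2 ^ l ≤ 2 ^ l * (l + suc l) + 1
    last l h = +-cancelʳ-≤ (1 + P) _ _ (begin
      t l (suc l) + P + (1 + P)
        ≡⟨ cong (λ m → T₄ m + P + (1 + P)) (solve 2 (λ l a → a :+ (con 1 :+ l) := con 1 :+ (a :+ con 0 :+ l)) refl l (tri l)) ⟩
      T₄ N + P + (1 + P)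
        ≡⟨ solve 2 (λ a p → a :+ p :+ (con 1 :+ p) := a :+ con 1 :+ (p :+ p)) refl (T₄ N) P ⟩
      T₄ N + 1 + (P + P)
        ≤⟨ +-monoˡ-≤ (P + P) (T₄-suc-≤ (tri l + 0) l (t l 0) ≤-refl) ⟩
      2 * t l 0 + 2 * P + (P + P)
        ≡⟨ solve 2 (λ t p → con 2 :* t :+ con 2 :* p :+ (p :+ p) := con 2 :* (t :+ p) :+ (p :+ p)) refl (t l 0) P ⟩
      2 * (t l 0 + P) + (P + P)
        ≤⟨ +-monoˡ-≤ (P + P) (*-monoʳ-≤ 2 h) ⟩
      2 * (P * (l + 0) + 1) + (P + P)
        ≡⟨ solve 2 (λ p l → con 2 :* (p :* (l :+ con 0) :+ con 1) :+ (p :+ p)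
                     := p :* (l :+ (con 1 :+ l)) :+ con 1 :+ (con 1 :+ p)) refl P l ⟩
      P * (l + suc l) + 1 + (1 + P) ∎)
      where
      P = 2 ^ l
      N = suc (tri l + 0 + l)
    mutual
      upto : ∀ l r → r ≤ l → t l r + 2 ^ l ≤ 2 ^ l * (l + r) + 1
      upto zero    .zero z≤n = ≤-reflexive (cong (_+ 1) (T-0 4 P₄))
      upto (suc l) r     h   = raise l r (go l r (m≤n⇒m<n∨m≡n h))
      go : ∀ l r → r < suc l ⊎ r ≡ suc l → t l r + 2 ^ l ≤ 2 ^ l * (l + r) + 1
      go l r  (inj₁ h)    = upto l r (s≤s⁻¹ h)
      go l ._ (inj₂ refl) = last l (upto l 0 z≤n)

  -- At level `l` the disks below `tri l` weigh exactly `offset l` and the other r + l weigh 2 ^ l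
  -- each, so the offsets in `tower-bound` cancel.
  T₄-lower : ∀ l r → 2 ^ suc l * (l + r) + 1 ≤ T₄ (suc (tri l + r + l))
  T₄-lower l r with transfer⁻ P₄ (proj₁ (T-isLeast (suc (tri l + r + l)) 4 P₄))
  ... | u , v , π , len , on-p , on-q = +-cancelʳ-≤ (2 * offset l) _ _ (begin
    2 * 2 ^ l * (l + r) + 1 + 2 * offset l
      ≡⟨ cong (_+ 2 * offset l) (solve 3 (λ p l r → con 2 :* p :* (l :+ r) :+ con 1 := con 2 :* (p :* (l :+ r)) :+ con 1) refl (2 ^ l) l r) ⟩
    2 * (2 ^ l * (l + r)) + 1 + 2 * offset l
      ≡⟨ solve 2 (λ a c → con 2 :* a :+ con 1 :+ con 2 :* c := con 2 :* (a :+ c) :+ con 1) refl (2 ^ l * (l + r)) (offset l) ⟩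
    2 * (2 ^ l * (l + r) + offset l) + 1
      ≡⟨ cong (λ x → 2 * x + 1) total≡ ⟨
    2 * totalWeight l (tri l + r + l) + 1
      ≤⟨ tower-bound (tri l + r + l) l source≢goal π on-p on-q ⟩
    length π + 2 * offset l
      ≡⟨ cong (_+ 2 * offset l) len ⟩
    T₄ (suc (tri l + r + l)) + 2 * offset l ∎)
    where
    open ≤-Reasoning
    open +-*-Solver
    totalWeight-tri′ : totalWeight l (tri l) ≡ offset l
    totalWeight-tri′ = +-cancelʳ-≡ (2 ^ l * suc l) _ _ (trans (sym (totalWeight-+ l (suc l)))
               (trans (cong (totalWeight l) (+-comm (tri l) (suc l))) (totalWeight-tri l)))
    total≡ : totalWeight l (tri l + r + l) ≡ 2 ^ l * (l + r) + offset l
    total≡ = trans (cong (totalWeight l) (+-assoc (tri l) r l)) (trans (totalWeight-+ l (r + l))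
           (trans (cong₂ (λ a b → a + 2 ^ l * b) totalWeight-tri′ (+-comm r l)) (+-comm (offset l) _)))

  -- Equivalently, n + 1 is tri (l + 1) + r: `r` grows until it is full, and then `l` does.
  triangular : ∀ n → ∃ λ l → ∃ λ r → r ≤ suc l × n ≡ tri l + r + l
  triangular zero = 0 , 0 , z≤n , refl
  triangular (suc n) with triangular n
  ... | l , r , r≤ , refl with m≤n⇒m<n∨m≡n r≤
  ...   | inj₁ r< = l , suc r , r< , sym (cong (_+ l) (+-suc (tri l) r))
  ...   | inj₂ refl = suc l , 0 , z≤n ,
    solve 2 (λ l a → con 1 :+ (a :+ (con 1 :+ l) :+ l) := con 1 :+ l :+ a :+ con 0 :+ (con 1 :+ l)) refl l (tri l)
    where open +-*-Solver

  attained : ∀ n → ∃ λ l → ∃ λ m → l + m ≡ n × 2 * T₄ l + 2 * T₃ m + 1 ≤ T₄ (suc n)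
  attained n with triangular n
  -- The middle tower gets `l` disks. The upper bounds then give 2 ^ (l + 1) (l + r) + 1, which is
  -- the value in `T₄-lower`; the summand 2 * 2 ^ l + 2 avoids subtraction.
  ... | l , r , r≤ , refl = tri l + r , l , refl , +-cancelʳ-≤ (2 * 2 ^ l + 2) _ _ (begin
    2 * T₄ (tri l + r) + 2 * T₃ l + 1 + (2 * 2 ^ l + 2)
      ≡⟨ solve 3 (λ a b p → con 2 :* a :+ con 2 :* b :+ con 1 :+ (con 2 :* p :+ con 2)
                   := con 2 :* (a :+ p) :+ con 2 :* (b :+ con 1) :+ con 1) refl (T₄ (tri l + r)) (T₃ l) (2 ^ l) ⟩
    2 * (T₄ (tri l + r) + 2 ^ l) + 2 * (T₃ l + 1) + 1
      ≤⟨ +-monoˡ-≤ 1 (+-mono-≤ (*-monoʳ-≤ 2 (T₄-upper l r r≤)) (*-monoʳ-≤ 2 (T₃-≤ l P₃))) ⟩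
    2 * (2 ^ l * (l + r) + 1) + 2 * 2 ^ l + 1
      ≡⟨ solve 3 (λ p l r → con 2 :* (p :* (l :+ r) :+ con 1) :+ con 2 :* p :+ con 1
                   := con 2 :* p :* (l :+ r) :+ con 1 :+ (con 2 :* p :+ con 2)) refl (2 ^ l) l r ⟩
    2 ^ suc l * (l + r) + 1 + (2 * 2 ^ l + 2)
      ≤⟨ +-monoˡ-≤ (2 * 2 ^ l + 2) (T₄-lower l r) ⟩
    T₄ (suc (tri l + r + l)) + (2 * 2 ^ l + 2) ∎)
    where
    open ≤-Reasoning
    open +-*-Solver

mainTheorem1 : (P₃ : Pegs 3) (P₄ : Pegs 4) →
    T 0 4 P₄ ≡ 0 ×
    (∀ n → n > 0 →
    ∃[ μ ]
    IsLeast (λ v → ∃[ l ] ∃[ m ] (l + m ≡ n ∸ 1 × v ≡ 2 * T l 4 P₄ + 2 * T m 3 P₃)) μ ×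
    T n 4 P₄ ≡ μ + 1)
mainTheorem1 P₃ P₄ = T-0 4 P₄ , recursion
  where
  recursion : ∀ n → n > 0 →
    ∃[ μ ]
    IsLeast (λ v → ∃[ l ] ∃[ m ] (l + m ≡ n ∸ 1 × v ≡ 2 * T l 4 P₄ + 2 * T m 3 P₃)) μ ×
    T n 4 P₄ ≡ μ + 1
  recursion (suc n) _ with attained P₃ P₄ n
  -- The split from `attained` gives the minimum: its value plus one is at most `T`, and `T₄-≤`
  -- bounds `T` by the value of every split plus one.
  ... | l , m , refl , le = _ , ((l , m , refl , refl) , least) , ≤-antisym (T₄-≤ P₃ P₄ l m) le
    where
    least : ∀ {v} → (∃[ l′ ] ∃[ m′ ] (l′ + m′ ≡ l + m × v ≡ 2 * T l′ 4 P₄ + 2 * T m′ 3 P₃)) →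
            2 * T l 4 P₄ + 2 * T m 3 P₃ ≤ v
    least (l′ , m′ , eq , refl) = +-cancelʳ-≤ 1 _ _
      (≤-trans le (subst (λ n → T (suc n) 4 P₄ ≤ 2 * T l′ 4 P₄ + 2 * T m′ 3 P₃ + 1) eq (T₄-≤ P₃ P₄ l′ m′)))
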